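{- Let $w, y \in \mathrm{CFC}(A_n)$ be cyclically fully commutative elements of the Coxeter group $W(A_n)$. Then $w$ and $y$ are conjugate in $W(A_n)$ if and only if their cylindrical heaps $\hat{H}(w)$ and $\hat{H}(y)$ are ring equivalent.
   Context: **The group.** $W(A_n)$ is the Coxeter group with generating set $S=\{s_1,\dots,s_n\}$ and relations $s_i^2=e$, $s_is_j=s_js_i$ for $|i-j|>1$, and $s_is_js_i=s_js_is_j$ for $|i-j|=1$ (it is isomorphic to the symmetric group $S_{n+1}$ via $s_i\mapsto (i\ i+1)$). **Expressions, FC and CFC.** An expression for $w$ is a word in $S$ whose product is $w$; it is reduced if it has minimal length among expressions for $w$. An element is fully commutative (FC) if any two of its reduced expressions differ by a sequence of commutations $s_is_j\mapsto s_js_i$ with $|i-j|>1$. A cyclic shift of a word is obtained by moving its first letter to the end, $s_{x_1}s_{x_2}\cdots s_{x_k}\mapsto s_{x_2}\cdots s_{x_k}s_{x_1}$, and iterating this move; the cyclic shifts of a word are all its rotations. An element $w$ is cyclically fully commutative (CFC) if every cyclic shift of every reduced expression for $w$ is a reduced expression for an FC element. $\mathrm{CFC}(A_n)$ is the set of CFC elements of $W(A_n)$. **Heaps.** The heap of a reduced expression $s_{x_1}\cdots s_{x_k}$ is the poset on $\{1,\dots,k\}$ whose order $\prec$ is the transitive closure of: $j\prec i$ if $i<j$ and $s_{x_i}$, $s_{x_j}$ do not commute (it follows that also $j \prec i$ whenever $i<j$ and $s_{x_i}=s_{x_j}$), with element $i$ labeled by $s_{x_i}$ (or $x_i$). Elements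 of a heap are called blocks; letters further left are higher in the heap. Heaps are considered up to isomorphism of labeled posets. All reduced expressions of an FC element $w$ have the same heap, denoted $H(w)$. **Cylindrical heaps.** If $w$ is CFC and has a reduced expression of the form $s_i\mathsf{u}$, the cyclic shift of $H(w)$ with respect to $i$ is the heap of $\mathsf{u}s_i$ (remove a block labeled $i$ from the top and append it to the bottom). Two heaps of CFC elements are cyclically equivalent if they differ by a sequence of cyclic shifts. The cylindrical heap $\hat{H}(w)$ is the equivalence class of heaps cyclically equivalent to $H(w)$. **Chunks and rings.** For $w\in \mathrm{CFC}(A_n)$, a chunk of size $m$ of $H(w)$ is a convex subheap of $H(w)$ consisting of $m$ blocks that corresponds to a maximal connected component of the Hasse diagram of $H(w)$. Two chunks are chunk equivalent if they differ by a sequence of cyclic shifts; the equivalence class $\hat{C}$ of a chunk $C$ is called a ring. All members of a ring have the same blocks (labels), and the number of blocks of the ring is the size of any chunk representing it. The cylindrical heap $\hat{H}(w)$ is regarded as the disjoint union of the rings $\hat C$, one for each chunk $C$ of $H(w)$. **Ring equivalence.** Suppose $\hat{H}(w)$ and $\hat{H}(w')$ consist exactly of the rings $R_1,\dots,R_k$ and $R'_1,\dots,R'_k$, respectively. They are ring equivalent if there is a bijection $R_i\leftrightarrow R'_i$ (between the two collections of rings) such that corresponding rings consist of the same number of blocks (not necessarily with the same labels). -}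

module Defs where

open import Level using (0ℓ; _⊔_) renaming (suc to lsuc)
open import Algebra.Bundles using (Group)
open import Data.Bool.Base using (true; false)
open import Data.Fin.Base as Fin using (Fin; zero; suc; toℕ)
open import Data.Fin.Properties using (<-trans; <-irrefl)
open import Data.Fin.Subset using (Subset; _∈_; Nonempty; ∣_∣)
open import Data.List.Base
  using (List; []; _∷_; _++_; _∷ʳ_; [_]; length; lookup; reverse)
open import Data.List.Properties
  using (++-assoc; ++-identityʳ; unfold-reverse; reverse-++; reverse-involutive)
open import Data.Nat.Base as ℕ using (ℕ; ∣_-_∣)
open import Data.Product.Base using (Σ-syntax; ∃-syntax; _×_; _,_)
open import Data.Sum.Base using (_⊎_)
open import Data.Vec.Base using ([]; _∷_)
open import Function.Base using (_on_)
open import Function.Bundles using (_⇔_; _↔_; Inverse)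
open import Relation.Binary.Bundles using (Setoid)
open import Relation.Binary.Construct.Closure.Equivalence as EqC using (EqClosure)
open import Relation.Binary.Construct.Closure.ReflexiveTransitive using (Star)
open import Relation.Binary.Construct.Closure.Transitive as Plus
  using (TransClosure; _∷_)
import Relation.Binary.Construct.On as On
open import Relation.Binary.Core using (Rel)
open import Relation.Binary.Structures using (IsStrictPartialOrder)
open import Relation.Binary.PropositionalEquality as ≡
  using (_≡_; refl; sym; trans; cong; subst)
open import Relation.Nullary.Negation.Core using (¬_)

private
  variable
    n : ℕ

Conjugate : ∀ {c ℓ} (G : Group c ℓ) → Rel (Group.Carrier G) (c ⊔ ℓ)
Conjugate G x y = ∃[ g ] y ≈ g ∙ x ∙ g ⁻¹
  where open Group G

------------------------------------------------------------------------
-- The Coxeter group W(Aₙ).  The generator s_{i+1} is `i : Fin n`, group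
-- elements are words, and `_≈_` is the congruence that the Coxeter
-- relations generate.

Word : ℕ → Set
Word n = List (Fin n)

Distant Adjacent : Rel (Fin n) 0ℓ
Distant  i j = ∣ toℕ i - toℕ j ∣ ℕ.> 1
Adjacent i j = ∣ toℕ i - toℕ j ∣ ≡ 1

infix 4 _≈_

data _≈_ {n : ℕ} : Rel (Word n) 0ℓ where
  square  : ∀ i → i ∷ i ∷ [] ≈ []
  commute : ∀ {i j} → Distant i j → i ∷ j ∷ [] ≈ j ∷ i ∷ []
  braid   : ∀ {i j} → Adjacent i j → i ∷ j ∷ i ∷ [] ≈ j ∷ i ∷ j ∷ []
  ++-cong : ∀ {u u′ v v′} → u ≈ u′ → v ≈ v′ → u ++ v ≈ u′ ++ v′
  ≈-refl  : ∀ {u} → u ≈ u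
  ≈-sym   : ∀ {u v} → u ≈ v → v ≈ u
  ≈-trans : ∀ {u v w} → u ≈ v → v ≈ w → u ≈ w

≈-reflexive : {u v : Word n} → u ≡ v → u ≈ v
≈-reflexive refl = ≈-refl

reverse-inverseˡ : (u : Word n) → reverse u ++ u ≈ []
reverse-inverseˡ []      = ≈-refl
reverse-inverseˡ (i ∷ u) = ≈-trans
  (≈-reflexive (trans (cong (_++ i ∷ u) (unfold-reverse i u))
                      (++-assoc (reverse u) [ i ] (i ∷ u))))
  (≈-trans (++-cong (≈-refl {u = reverse u}) (++-cong (square i) (≈-refl {u = u})))
           (reverse-inverseˡ u))

reverse-inverseʳ : (u : Word n) → u ++ reverse u ≈ []
reverse-inverseʳ u =
  subst (λ v → v ++ reverse u ≈ []) (reverse-involutive u)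
        (reverse-inverseˡ (reverse u))

reverse-cong : {u v : Word n} → u ≈ v → reverse u ≈ reverse v
reverse-cong (square i)    = square i
reverse-cong (commute d)   = ≈-sym (commute d)
reverse-cong (braid a)     = braid a
reverse-cong (++-cong {u} {u′} {v} {v′} p q) = ≈-trans
  (≈-reflexive (reverse-++ u v))
  (≈-trans (++-cong (reverse-cong q) (reverse-cong p))
           (≈-reflexive (sym (reverse-++ u′ v′))))
reverse-cong ≈-refl        = ≈-refl
reverse-cong (≈-sym p)     = ≈-sym (reverse-cong p)
reverse-cong (≈-trans p q) = ≈-trans (reverse-cong p) (reverse-cong q)

W-A : ℕ → Group 0ℓ 0ℓ
W-A n = record
  { Carrier = Word n
  ; _≈_     = _≈_
  ; _∙_     = _++_
  ; ε       = []
  ; _⁻¹     = reverse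
  ; isGroup = record
    { isMonoid = record
      { isSemigroup = record
        { isMagma = record
          { isEquivalence = record { refl = ≈-refl ; sym = ≈-sym ; trans = ≈-trans }
          ; ∙-cong        = ++-cong
          }
        ; assoc = λ u v w → ≈-reflexive (++-assoc u v w)
        }
      ; identity = (λ _ → ≈-refl) , λ u → ≈-reflexive (++-identityʳ u)
      }
    ; inverse = reverse-inverseˡ , reverse-inverseʳ
    ; ⁻¹-cong = reverse-cong
    }
  }

------------------------------------------------------------------------
-- Reduced expressions, FC and CFC elements

Reduced : Word n → Set
Reduced u = ∀ v → v ≈ u → length u ℕ.≤ length v

_IsReducedExpressionOf_ : Rel (Word n) 0ℓ
u IsReducedExpressionOf w = u ≈ w × Reduced u

data Commutation {n : ℕ} : Rel (Word n) 0ℓ where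
  swap : ∀ p {i j} q → Distant i j →
         Commutation (p ++ i ∷ j ∷ q) (p ++ j ∷ i ∷ q)

FC : Word n → Set
FC w = ∀ {u v} → u IsReducedExpressionOf w → v IsReducedExpressionOf w →
       Star Commutation u v

data Rotation {n : ℕ} : Rel (Word n) 0ℓ where
  rotate : ∀ i u → Rotation (i ∷ u) (u ∷ʳ i)

CFC : Word n → Set
CFC w = ∀ {u v} → u IsReducedExpressionOf w → Star Rotation u v →
        Reduced v × FC v

------------------------------------------------------------------------
-- Heaps

record Heap (n : ℕ) : Set₁ where
  infix 4 _≺_
  field
    size                 : ℕ
    _≺_                  : Rel (Fin size) 0ℓ
    isStrictPartialOrder : IsStrictPartialOrder _≡_ _≺_
    label                : Fin size → Fin n

  -- The edges of the Hasse diagram.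
  _⋖_ : Rel (Fin size) 0ℓ
  a ⋖ b = a ≺ b × ¬ (∃[ c ] a ≺ c × c ≺ b)

  Connected : Rel (Fin size) 0ℓ
  Connected = EqClosure _⋖_

record _≅_ (H K : Heap n) : Set where
  private
    module H = Heap H
    module K = Heap K
  field
    blocks    : Fin H.size ↔ Fin K.size
  open Inverse blocks using (to) public
  field
    ≺-iso     : ∀ a b → a H.≺ b ⇔ to a K.≺ to b
    label-iso : ∀ a → K.label (to a) ≡ H.label a

NonCommuting : Rel (Fin n) 0ℓ
NonCommuting i j = ¬ (i ∷ j ∷ [] ≈ j ∷ i ∷ [])

module _ (u : Word n) where

  -- `b` lies below `a` when it stands further right in the word.
  data Below : Rel (Fin (length u)) 0ℓ where
    below : ∀ {a b} → a Fin.< b → NonCommuting (lookup u a) (lookup u b) →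
            Below b a

  Below⁺⇒> : ∀ {a b} → TransClosure Below b a → a Fin.< b
  Below⁺⇒> Plus.[ below a<b _ ]   = a<b
  Below⁺⇒> (below c<b _ ∷ c≺⁺a) = <-trans (Below⁺⇒> c≺⁺a) c<b

  heap : Heap n
  heap = record
    { size                 = length u
    ; _≺_                  = TransClosure Below
    ; isStrictPartialOrder = record
      { isEquivalence = ≡.isEquivalence
      ; irrefl        = λ { refl a≺a → <-irrefl refl (Below⁺⇒> a≺a) }
      ; trans         = Plus._++_
      ; <-resp-≈      = (λ { refl p → p }) , (λ { refl p → p })
      }
    ; label                = lookup u
    }

------------------------------------------------------------------------
-- Cylindrical heaps

CyclicShift : Fin n → Rel (Heap n) 0ℓ
CyclicShift i H K =
  ∃[ u ] CFC (i ∷ u) × Reduced (i ∷ u) × H ≅ heap (i ∷ u) × K ≅ heap (u ∷ʳ i)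

-- Isomorphisms are steps too, because heaps are taken up to isomorphism.
infix 4 _∼_

_∼_ : Rel (Heap n) (lsuc 0ℓ)
_∼_ = EqClosure λ H K → H ≅ K ⊎ ∃[ i ] CyclicShift i H K

-- The cylindrical heap of `w`, as a class of heaps.
Ĥ : Word n → Heap n → Set₁
Ĥ w H = ∃[ u ] u IsReducedExpressionOf w × heap u ∼ H

------------------------------------------------------------------------
-- Chunks and rings

-- The increasing enumeration of a subset.
enumerate : ∀ {k} (C : Subset k) → Fin ∣ C ∣ → Fin k
enumerate (true  ∷ C) zero    = zero
enumerate (true  ∷ C) (suc a) = suc (enumerate C a)
enumerate (false ∷ C) a       = suc (enumerate C a)

subheap : (H : Heap n) → Subset (Heap.size H) → Heap n
subheap H C = record
  { size                 = ∣ C ∣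
  ; _≺_                  = _≺_ on enumerate C
  ; isStrictPartialOrder = record
    { isEquivalence = ≡.isEquivalence
    ; irrefl        = λ { refl → SPO.irrefl refl }
    ; trans         = SPO.trans
    ; <-resp-≈      = (λ { refl p → p }) , (λ { refl p → p })
    }
  ; label                = λ a → label (enumerate C a)
  }
  where
  open Heap H
  module SPO = IsStrictPartialOrder isStrictPartialOrder

record Chunk (H : Heap n) : Set where
  open Heap H using (_≺_; Connected) renaming (size to sizeᴴ)
  field
    support   : Subset sizeᴴ
    nonempty  : Nonempty support
    component : ∀ {a} → a ∈ support → ∀ b → b ∈ support ⇔ Connected a b
    convex    : ∀ {a b c} → a ∈ support → c ∈ support → a ≺ b → b ≺ c → b ∈ support

  asHeap : Heap n
  asHeap = subheap H support

  size : ℕ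
  size = ∣ support ∣

-- A ring is represented by a chunk; equality of rings is chunk equivalence.
Rings : Heap n → Setoid 0ℓ (lsuc 0ℓ)
Rings {n} H = record
  { Carrier       = Chunk H
  ; _≈_           = _∼_ on Chunk.asHeap
  ; isEquivalence = On.isEquivalence Chunk.asHeap
                      (EqC.isEquivalence {A = Heap n}
                        λ H K → H ≅ K ⊎ ∃[ i ] CyclicShift i H K)
  }

-- A relation between cylindrical heaps, expressed on representatives.
RingEquivalent : Rel (Heap n) (lsuc 0ℓ)
RingEquivalent H K =
  Σ[ φ ∈ Inverse (Rings H) (Rings K) ]
    ∀ C → Chunk.size (Inverse.to φ C) ≡ Chunk.size C

{-# OPTIONS --safe #-}
module Submission where

-- In a CFC word no letter is repeated: two equal letters a need letters a+1 in
-- both cyclic gaps between them (otherwise a gap without a+1 leads, descending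
-- to smaller letters, to a square or a braid), so a+1 is repeated as well, and
-- so on beyond the last letter.  Rotations and commutations therefore sort the
-- word, and it is conjugate to the increasing product of its set S of letters.
-- As a permutation of 0, …, n this product is a cycle on each block, a maximal
-- interval joined by letters of S; the chunks of the heap are the blocks with
-- more than one point.  A conjugating element maps blocks onto blocks of equal
-- length.  Conversely a length-preserving bijection of the nontrivial blocks
-- extends to a permutation intertwining the two products, and the action of
-- W(Aₙ) on points is faithful.

open import Defs
open import Algebra.Bundles using (Group)
open import Data.Bool.Base using (Bool; true; false; if_then_else_)
open import Data.Bool.Properties as Bool using (¬-not)
open import Data.Empty using (⊥; ⊥-elim)
open import Data.Fin.Base as Fin using (Fin; zero; suc; toℕ; fromℕ<)
open import Data.Fin.Properties as Fin
  using (toℕ<n; toℕ-injective; toℕ-fromℕ<; injective⇒≤)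
open import Data.Fin.Subset using (Subset) renaming (_∈_ to _∈ₛ_)
open import Data.Fin.Subset.Properties using (⊆-antisym)
open import Data.List.Base using (List; []; _∷_; _++_; _∷ʳ_; [_]; length; lookup; map; reverse)
open import Data.List.Properties using (++-assoc; ++-identityʳ; map-++; length-++)
open import Data.List.Membership.Propositional using (_∈_; _∉_)
open import Data.List.Membership.Propositional.Properties
  using (∈-∃++; ∈-lookup; ∈-map⁺; ∈-map⁻)
open import Data.List.Relation.Binary.Permutation.Propositional as Perm
  using (_↭_; ↭-sym; ↭-trans; ↭-refl; ↭-reflexive; prep; swap)
open import Data.List.Relation.Binary.Permutation.Propositional.Properties
  using (∈-resp-↭; ↭-length; drop-∷; ∷↭∷ʳ; ++⁺ˡ; ↭-singleton-inv)
  renaming (shift to ↭-shift; ++-comm to ++-↭-comm)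
import Data.List.Relation.Binary.Permutation.Setoid.Properties as SetoidPerm
open import Data.List.Relation.Unary.All as All using (All; []; _∷_)
open import Data.List.Relation.Unary.All.Properties as All using (++⁻)
open import Data.List.Relation.Unary.AllPairs using ([]; _∷_)
open import Data.List.Relation.Unary.Any as Any using (Any; here; there; index)
open import Data.List.Relation.Unary.Any.Properties using (lookup-index)
open import Data.List.Relation.Unary.Unique.Propositional using (Unique)
import Data.List.Relation.Unary.Unique.Propositional.Properties as Unique
open import Data.Nat.Base using (ℕ; zero; suc; _+_; _∸_; _≤_; _<_; _>_; z≤n; s≤s; s≤s⁻¹; ∣_-_∣)
open import Data.Nat.Properties
open import Data.Product.Base using (∃; ∃₂; ∃-syntax; _×_; _,_; proj₁; proj₂)
open import Data.Sum.Base as Sum using (_⊎_; inj₁; inj₂)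
open import Data.Vec.Base using ([]; _∷_; tabulate; here; there)
open import Data.Vec.Properties using (lookup∘tabulate; []=⇒lookup; lookup⇒[]=)
open import Function.Base using (_∘_; id; case_of_)
open import Function.Bundles using (_⇔_; mk⇔; Equivalence; Inverse)
open import Function.Properties.Inverse using (↔-sym)
open import Relation.Binary.Construct.Closure.Equivalence as EqC using ()
open import Relation.Binary.Construct.Closure.ReflexiveTransitive using (Star; ε; _◅_; _◅◅_)
open import Relation.Binary.Construct.Closure.Symmetric using (fwd; bwd)
open import Relation.Binary.Construct.Closure.Transitive as Plus using (TransClosure; _∷_)
open import Relation.Binary.Definitions using (tri<; tri≈; tri>)
open import Relation.Binary.PropositionalEquality hiding ([_])
import Relation.Binary.Reasoning.Setoid as SetoidReasoning
open import Relation.Nullary using (¬_; Dec; yes; no; does)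
open import Relation.Nullary.Decidable using (_×-dec_; dec-true)
open import Relation.Nullary.Negation using (contradiction)
open import Relation.Unary using (Pred; Decidable)

private
  variable
    n : ℕ

-- The group is given by a presentation, so neither the inequality of two elements nor the equation
-- for a conjugator can be read off words. Both pass through the action on points: it refutes the
-- commutation of neighbouring generators, and it turns a permutation that intertwines two sorted
-- products into an identity of words. The other obstacle is that `Ĥ` hands over an arbitrary heap
-- of its class, and that rings are compared along chains of heaps whose order changes at every
-- cyclic shift. What survives is the set of labels. Hence `Supports S H` describes `H` in terms of
-- the letter set `S`, and a chunk is recovered from any one of its labels. Letter sets and points
-- live in ℕ rather than in `Fin n`: removing the smallest letter is then the precomposition
-- `S ∘ suc`, and a letter `i` is compared without casts with the points `i` and `i + 1` that it
-- joins. A block is named by its least point.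

module ≈-Reasoning {n} = SetoidReasoning (Group.setoid (W-A n))

-- Words: congruences, commuting letters, distances between letters

++-congˡ : ∀ x {u v : Word n} → u ≈ v → x ++ u ≈ x ++ v
++-congˡ x = ++-cong (≈-refl {u = x})

++-congʳ : ∀ x {u v : Word n} → u ≈ v → u ++ x ≈ v ++ x
++-congʳ x p = ++-cong p (≈-refl {u = x})

-- All relations depend only on differences of letters. This lifts identities of rank `n` to the
-- subgroup generated by all letters but the first, as the induction over cosets requires.
map-suc-cong : {u v : Word n} → u ≈ v → map suc u ≈ map suc v
map-suc-cong (square i)  = square (suc i)
map-suc-cong (commute d) = commute d
map-suc-cong (braid a)   = braid a
map-suc-cong (++-cong {u} {u′} {v} {v′} p q) = ≈-trans
  (≈-reflexive (map-++ suc u v))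
  (≈-trans (++-cong (map-suc-cong p) (map-suc-cong q))
           (≈-reflexive (sym (map-++ suc u′ v′))))
map-suc-cong ≈-refl        = ≈-refl
map-suc-cong (≈-sym p)     = ≈-sym (map-suc-cong p)
map-suc-cong (≈-trans p q) = ≈-trans (map-suc-cong p) (map-suc-cong q)

commute-past : ∀ {i : Fin n} {u} → All (Distant i) u → i ∷ u ≈ u ∷ʳ i
commute-past []                      = ≈-refl
commute-past {u = j ∷ u} (d ∷ ds) =
  ≈-trans (++-congʳ u (commute d)) (++-congˡ [ j ] (commute-past ds))

commute-past-++ : ∀ {i : Fin n} {u} v → All (Distant i) u → i ∷ u ++ v ≈ u ++ i ∷ v
commute-past-++ {i = i} {u} v ds =
  ≈-trans (++-congʳ v (commute-past ds)) (≈-reflexive (++-assoc u [ i ] v))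

data DistanceView (i j : Fin n) : Set where
  equal    : i ≡ j → DistanceView i j
  succ     : toℕ j ≡ suc (toℕ i) → DistanceView i j
  pred     : toℕ i ≡ suc (toℕ j) → DistanceView i j
  distant  : Distant i j → DistanceView i j

distanceView : (i j : Fin n) → DistanceView i j
distanceView zero          zero          = equal refl
distanceView zero          (suc zero)    = succ refl
distanceView zero          (suc (suc j)) = distant (s≤s (s≤s z≤n))
distanceView (suc zero)    zero          = pred refl
distanceView (suc (suc i)) zero          = distant (s≤s (s≤s z≤n))
distanceView (suc i)       (suc j) with distanceView i j
... | equal refl = equal refl
... | succ p     = succ (cong suc p)
... | pred p     = pred (cong suc p)
... | distant d  = distant d

adjacent-suc : {i j : Fin n} → toℕ i ≡ suc (toℕ j) → Adjacent i j
adjacent-suc {i = suc zero}    {zero}  p = refl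
adjacent-suc {i = suc i}       {suc j} p = adjacent-suc {i = i} {j} (suc-injective p)

distant-sym : {i j : Fin n} → Distant i j → Distant j i
distant-sym {i = i} {j} = subst (_> 1) (∣-∣-comm (toℕ i) (toℕ j))

-- FC elements: gaps between equal letters

first-occurrence : ∀ {a p} {A : Set a} {P : Pred A p} → Decidable P → ∀ xs →
  All (¬_ ∘ P) xs ⊎ (∃₂ λ ys b → ∃ λ zs → xs ≡ ys ++ b ∷ zs × All (¬_ ∘ P) ys × P b)
first-occurrence P? [] = inj₁ []
first-occurrence P? (x ∷ xs) with P? x
... | yes px = inj₂ ([] , x , xs , refl , [] , px)
... | no ¬px with first-occurrence P? xs
...   | inj₁ none = inj₁ (¬px ∷ none)
...   | inj₂ (ys , b , zs , eq , none , pb) =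
          inj₂ (x ∷ ys , b , zs , cong (x ∷_) eq , ¬px ∷ none , pb)

Commutation⇒↭ : {u v : Word n} → Commutation u v → u ↭ v
Commutation⇒↭ (swap p q _) = ++⁺ˡ p (swap _ _ ↭-refl)

Commutation*⇒↭ : {u v : Word n} → Star Commutation u v → u ↭ v
Commutation*⇒↭ ε        = ↭-refl
Commutation*⇒↭ (s ◅ ss) = ↭-trans (Commutation⇒↭ s) (Commutation*⇒↭ ss)

↭-cancelˡ : ∀ {a} {A : Set a} (xs : List A) {ys zs} → xs ++ ys ↭ xs ++ zs → ys ↭ zs
↭-cancelˡ []       p = p
↭-cancelˡ (x ∷ xs) p = ↭-cancelˡ xs (drop-∷ p)

∷-cancelʳ : ∀ {a} {A : Set a} {x y : A} zs → x ∷ zs ↭ y ∷ zs → x ≡ y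
∷-cancelʳ {x = x} {y} zs p
  with ↭-singleton-inv (↭-cancelˡ zs (↭-trans (↭-sym (∷↭∷ʳ x zs)) (↭-trans p (∷↭∷ʳ y zs))))
... | refl = refl

-- The two words have different multisets of letters unless `x ≡ y`: after one swap both begin with
-- `y`, `x`, and only the third letters differ.
braid-not-↭ : ∀ {a} {A : Set a} {x y : A} p q →
  p ++ x ∷ y ∷ x ∷ q ↭ p ++ y ∷ x ∷ y ∷ q → x ≡ y
braid-not-↭ {x = x} {y} p q r =
  ∷-cancelʳ q (drop-∷ (drop-∷ (↭-trans (swap y x ↭-refl) (↭-cancelˡ p r))))

ReducedFC : Word n → Set
ReducedFC u = Reduced u × FC u

Reduced-resp-≈ : {u v : Word n} → Reduced u → v ≈ u → length v ≤ length u → Reduced v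
Reduced-resp-≈ red v≈u le w w≈v = ≤-trans le (red w (≈-trans w≈v v≈u))

-- The first `a` commutes through the gap and cancels against the second, which leaves a shorter
-- word for the same element.
no-square : ∀ x {a : Fin n} y z → All (Distant a) y → ¬ Reduced (x ++ a ∷ y ++ a ∷ z)
no-square x {a} y z ds red = <⇒≱ shorter (red (x ++ y ++ z) (≈-sym shorten))
  where
  shorten : x ++ a ∷ y ++ a ∷ z ≈ x ++ y ++ z
  shorten = ++-congˡ x (begin
    a ∷ y ++ a ∷ z ≈⟨ commute-past-++ (a ∷ z) ds ⟩
    y ++ a ∷ a ∷ z ≈⟨ ++-congˡ y (++-congʳ z (square a)) ⟩
    y ++ z         ∎)
    where open ≈-Reasoning
  -- The permutation serves to count letters: the original word has exactly two more.
  insertions : x ++ a ∷ y ++ a ∷ z ↭ a ∷ a ∷ x ++ y ++ z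
  insertions = ↭-trans (↭-shift a x _)
    (prep a (↭-trans (++⁺ˡ x (↭-shift a y z)) (↭-shift a x _)))
  shorter : length (x ++ y ++ z) < length (x ++ a ∷ y ++ a ∷ z)
  shorter = subst (length (x ++ y ++ z) <_) (sym (↭-length insertions)) (m<n⇒m<1+n ≤-refl)

-- Both letters `a` move through the gap until they touch `b`. The words before and after the braid
-- are reduced expressions of one element, but commutations preserve the multiset of letters and the
-- braid does not.
no-braid : ∀ x {a b : Fin n} y₁ y₂ z → Adjacent a b → a ≢ b →
  All (Distant a) y₁ → All (Distant a) y₂ → ¬ ReducedFC (x ++ a ∷ y₁ ++ b ∷ y₂ ++ a ∷ z)
no-braid x {a} {b} y₁ y₂ z adj a≢b d₁ d₂ (red , fc) =
  a≢b (braid-not-↭ p q (Commutation*⇒↭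
    (fc (eq  , Reduced-resp-≈ red eq (≤-reflexive len))
        (eq′ , Reduced-resp-≈ red eq′ (≤-reflexive (trans len′ len))))))
  where
  p = x ++ y₁
  q = y₂ ++ z
  u = x ++ a ∷ y₁ ++ b ∷ y₂ ++ a ∷ z
  eq : p ++ a ∷ b ∷ a ∷ q ≈ u
  eq = begin
    (x ++ y₁) ++ a ∷ b ∷ a ∷ y₂ ++ z ≡⟨ ++-assoc x y₁ _ ⟩
    x ++ y₁ ++ a ∷ b ∷ a ∷ y₂ ++ z   ≈⟨ ++-congˡ x (++-congˡ y₁ (++-congˡ (a ∷ b ∷ []) (commute-past-++ z d₂))) ⟩
    x ++ y₁ ++ a ∷ b ∷ y₂ ++ a ∷ z   ≈⟨ ++-congˡ x (commute-past-++ _ d₁) ⟨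
    u ∎
    where open ≈-Reasoning
  eq′ : p ++ b ∷ a ∷ b ∷ q ≈ u
  eq′ = ≈-trans (++-congˡ p (++-congʳ q (≈-sym (braid adj)))) eq
  len : length (p ++ a ∷ b ∷ a ∷ q) ≡ length u
  len = ↭-length (↭-trans (↭-reflexive (++-assoc x y₁ _)) (++⁺ˡ x
          (↭-trans (↭-shift a y₁ _) (prep a (++⁺ˡ y₁ (prep b (↭-sym (↭-shift a y₂ z))))))))
  len′ : length (p ++ b ∷ a ∷ b ∷ q) ≡ length (p ++ a ∷ b ∷ a ∷ q)
  len′ = trans (length-++ p) (sym (length-++ p))

distant-unless : ∀ {a b : Fin n} → toℕ b ≢ suc (toℕ a) → b ≢ a → suc (toℕ b) ≢ toℕ a → Distant a b
distant-unless {a = a} {b} p q r with distanceView a b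
... | equal e   = contradiction (sym e) q
... | succ e    = contradiction e p
... | pred e    = contradiction (sym e) r
... | distant d = d

-- Two letters a with no a+1 between them need, after shrinking the gap, two
-- letters a-1 in it, with no a between those: descend to the letter 0.
no-gap : ∀ m {a : Fin n} x y z → toℕ a ≡ m → All (λ b → toℕ b ≢ suc (toℕ a)) y →
  ¬ ReducedFC (x ++ a ∷ y ++ a ∷ z)
no-minimal-gap : ∀ m {a : Fin n} x y z → toℕ a ≡ m → All (λ b → toℕ b ≢ suc (toℕ a)) y → All (_≢ a) y →
  ¬ ReducedFC (x ++ a ∷ y ++ a ∷ z)

no-gap m {a} x y z eq none r with first-occurrence (Fin._≟ a) y
... | inj₁ none′ = no-minimal-gap m x y z eq none none′ r
... | inj₂ (y₁ , .a , y₂ , refl , none′ , refl) =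
  no-minimal-gap m x y₁ (y₂ ++ a ∷ z) eq (proj₁ (++⁻ y₁ none)) none′
    (subst ReducedFC (cong (λ v → x ++ a ∷ v) (++-assoc y₁ (a ∷ y₂) (a ∷ z))) r)

no-minimal-gap m {a} x y z eq none none′ r
  with first-occurrence (λ b → suc (toℕ b) ≟ toℕ a) y
-- Without `a-1`, `a` and `a+1`, every letter of the gap commutes with `a`.
... | inj₁ none″ = no-square x y z
      (All.zipWith (λ { ((p , q) , r) → distant-unless p q r }) (All.zip (none , none′) , none″)) (proj₁ r)
... | inj₂ (y₁ , b , y₂ , refl , none₁ , b+1≡a)
    with first-occurrence (λ b → suc (toℕ b) ≟ toℕ a) y₂
-- A single `a-1` in the gap: the letters on either side of it commute with `a`.
...   | inj₁ none₂ =
        no-braid x y₁ y₂ z (adjacent-suc (sym b+1≡a)) (λ { refl → 1+n≢n b+1≡a })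
          (All.zipWith (λ { ((p , q) , r) → distant-unless p q r })
            (All.zip (proj₁ (++⁻ y₁ none) , proj₁ (++⁻ y₁ none′)) , none₁))
          (All.zipWith (λ { ((p , q) , r) → distant-unless p q r })
            (All.zip (All.tail (proj₂ (++⁻ y₁ none)) , All.tail (proj₂ (++⁻ y₁ none′))) , none₂))
          (subst ReducedFC (cong (λ v → x ++ a ∷ v) (++-assoc y₁ (b ∷ y₂) (a ∷ z))) r)
no-minimal-gap zero {a} x y z eq none none′ r
  | inj₂ (y₁ , b , .(y₃ ++ c ∷ y₄) , refl , none₁ , b+1≡a)
  | inj₂ (y₃ , c , y₄ , refl , none₂ , c+1≡a) = contradiction (trans b+1≡a eq) λ ()
no-minimal-gap (suc m) {a} x y z eq none none′ r
  | inj₂ (y₁ , b , .(y₃ ++ c ∷ y₄) , refl , none₁ , b+1≡a)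
  | inj₂ (y₃ , c , y₄ , refl , none₂ , c+1≡a)
  with refl ← toℕ-injective {i = b} {c} (suc-injective (trans b+1≡a (sym c+1≡a))) =
  no-gap m (x ++ a ∷ y₁) y₃ (y₄ ++ a ∷ z) (suc-injective (trans b+1≡a eq)) gap
    (subst ReducedFC assoc r)
  where
  -- The gap between the two letters `b` avoids `a`, which is the successor of `b`: this is the
  -- hypothesis of `no-gap` one letter lower.
  gap = All.map (λ d≢a d≡a → d≢a (toℕ-injective (trans d≡a b+1≡a)))
          (proj₁ (++⁻ y₃ (All.tail (proj₂ (++⁻ y₁ none′)))))
  assoc : x ++ a ∷ (y₁ ++ b ∷ y₃ ++ b ∷ y₄) ++ a ∷ z ≡
          (x ++ a ∷ y₁) ++ b ∷ y₃ ++ b ∷ y₄ ++ a ∷ z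
  assoc = trans (cong (λ v → x ++ a ∷ v)
                  (trans (++-assoc y₁ _ (a ∷ z)) (cong (λ v → y₁ ++ b ∷ v) (++-assoc y₃ _ (a ∷ z)))))
                (sym (++-assoc x (a ∷ y₁) _))

-- CFC elements have no repeated letters

Rotation-++ : ∀ (x y : Word n) → Star Rotation (x ++ y) (y ++ x)
Rotation-++ []      y = subst (Star Rotation y) (sym (++-identityʳ y)) ε
Rotation-++ (i ∷ x) y = rotate i (x ++ y) ◅
  subst₂ (Star Rotation) (sym (++-assoc x y [ i ])) (++-assoc y [ i ] x) (Rotation-++ x (y ∷ʳ i))

-- Turns the gap that runs around the ends of the word into an inner one, so that `no-gap` covers
-- both cyclic gaps.
rotate-gap : ∀ x {a : Fin n} y z → Star Rotation (x ++ a ∷ y ++ a ∷ z) (a ∷ (z ++ x) ++ a ∷ y)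
rotate-gap x {a} y z = subst₂ (Star Rotation)
  (++-assoc x (a ∷ y) (a ∷ z)) (cong (a ∷_) (sym (++-assoc z x (a ∷ y))))
  (Rotation-++ (x ++ a ∷ y) (a ∷ z))

-- Quantifying over all rotations at once lets the hypothesis pass to any rotation, as the ascent to
-- larger letters needs.
Cyclically : (Word n → Set) → Word n → Set
Cyclically P u = ∀ {v} → Star Rotation u v → P v

-- At most one of the two cyclic gaps between two letters a contains a+1,
-- unless a+1 is repeated too.
no-repetition : ∀ k x {a : Fin n} y z → n ≤ toℕ a + k → ¬ Cyclically ReducedFC (x ++ a ∷ y ++ a ∷ z)
-- The bound `k` on the number of letters from `a` upwards is exhausted, so `a` would be out of
-- range.
no-repetition zero    x {a} y z n≤a _ =
  contradiction (toℕ<n a) (≤⇒≯ (subst (_ ≤_) (+-identityʳ (toℕ a)) n≤a))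
no-repetition {n} (suc k) x {a} y z n≤a cyc
  with first-occurrence (λ b → toℕ b ≟ suc (toℕ a)) y
... | inj₁ none = no-gap _ x y z refl none (cyc ε)
... | inj₂ (y₁ , b , y₂ , refl , _ , eq)
    with first-occurrence (λ b → toℕ b ≟ suc (toℕ a)) (z ++ x)
...   | inj₁ none = no-gap _ [] (z ++ x) y refl none (cyc (rotate-gap x y z))
...   | inj₂ (p , c , q , zx≡ , _ , eq′)
  with refl ← toℕ-injective {i = b} {c} (trans eq (sym eq′)) =
  no-repetition k (a ∷ p) (q ++ a ∷ y₁) y₂
    (subst (n ≤_) (trans (+-suc (toℕ a) k) (cong (_+ k) (sym eq))) n≤a)
    λ s → cyc (subst (Star Rotation _) assoc (rotate-gap x y z) ◅◅ s)
  where
  assoc : a ∷ (z ++ x) ++ a ∷ y₁ ++ b ∷ y₂ ≡ (a ∷ p) ++ b ∷ (q ++ a ∷ y₁) ++ b ∷ y₂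
  assoc = cong (a ∷_) (trans (cong (_++ a ∷ y₁ ++ b ∷ y₂) zx≡)
            (trans (++-assoc p (b ∷ q) _) (cong (λ v → p ++ b ∷ v) (sym (++-assoc q (a ∷ y₁) _)))))

unique-or-repeats : ∀ (u : Word n) → Unique u ⊎ (∃₂ λ x a → ∃₂ λ y z → u ≡ x ++ a ∷ y ++ a ∷ z)
unique-or-repeats [] = inj₁ []
unique-or-repeats (a ∷ u) with first-occurrence (a Fin.≟_) u
... | inj₂ (y , .a , z , refl , _ , refl) = inj₂ ([] , a , y , z , refl)
... | inj₁ none with unique-or-repeats u
...   | inj₁ uniq                    = inj₁ (none ∷ uniq)
...   | inj₂ (x , b , y , z , refl) = inj₂ (a ∷ x , b , y , z , refl)

CFC⇒Unique : {w u : Word n} → CFC w → u IsReducedExpressionOf w → Unique u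
CFC⇒Unique {n} {u = u} cfc red with unique-or-repeats u
... | inj₁ uniq                    = uniq
... | inj₂ (x , a , y , z , refl) =
  ⊥-elim (no-repetition n x y z (m≤n+m n (toℕ a)) (cfc red))

-- Rotations and commutations sort the letters

data Step {n : ℕ} (u v : Word n) : Set where
  rotation    : Rotation u v → Step u v
  commutation : Commutation u v → Step u v

Step⇒↭ : {u v : Word n} → Step u v → u ↭ v
Step⇒↭ (rotation (rotate i u)) = ∷↭∷ʳ i u
Step⇒↭ (commutation s)         = Commutation⇒↭ s

Unique-resp-↭ : {u v : Word n} → u ↭ v → Unique u → Unique v
Unique-resp-↭ {n} p = SetoidPerm.Unique-resp-↭ (setoid (Fin n)) (Perm.↭⇒↭ₛ p)

Commutation-map-suc : {u v : Word n} → Commutation u v → Commutation (map suc u) (map suc v)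
Commutation-map-suc (swap p {i} {j} q d) = subst₂ Commutation
  (sym (map-++ suc p (i ∷ j ∷ q))) (sym (map-++ suc p (j ∷ i ∷ q))) (swap (map suc p) (map suc q) d)

Step-map-suc : {u v : Word n} → Step u v → Step (map suc u) (map suc v)
Step-map-suc (rotation (rotate i u)) =
  rotation (subst (Rotation (map suc (i ∷ u))) (sym (map-++ suc u [ i ])) (rotate (suc i) (map suc u)))
Step-map-suc (commutation s) = commutation (Commutation-map-suc s)

commute-past-* : ∀ (p : Word n) {i} q r → All (Distant i) q →
  Star Step (p ++ q ++ i ∷ r) (p ++ i ∷ q ++ r)
commute-past-* p     []      r []       = ε
commute-past-* p {i} (j ∷ q) r (d ∷ ds) =
  subst₂ (Star Step) (++-assoc p [ j ] _) (++-assoc p [ j ] _) (commute-past-* (p ∷ʳ j) q r ds) ◅◅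
  commutation (swap p (q ++ r) (distant-sym {i = i} {j} d)) ◅ ε

-- A step on the shifted letters can be simulated while the letter 0 ends up in front again. A
-- rotated letter that is distant from 0 first passes it and then rotates.
Step-0∷map-suc : {u v : Word n} → Unique u → Step u v →
  Star Step (zero ∷ map suc u) (zero ∷ map suc v)
Step-0∷map-suc _ (commutation s) with Commutation-map-suc s
... | s′ = commutation (extend s′) ◅ ε
  where
  extend : ∀ {m} {i : Fin m} {u v} → Commutation u v → Commutation (i ∷ u) (i ∷ v)
  extend {i = i} (swap p q d) = swap (i ∷ p) q d
Step-0∷map-suc _ (rotation (rotate (suc i) u)) =
  commutation (swap [] (map suc u) (s≤s (s≤s z≤n))) ◅
  rotation (rotate (suc (suc i)) (zero ∷ map suc u)) ◅
  subst (λ v → Star Step (zero ∷ map suc u ++ [ suc (suc i) ]) (zero ∷ v)) (sym (map-++ suc u [ suc i ])) ε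
-- The letter 1 cannot pass 0. Instead 0 rotates to the end and comes back to stand just behind 1,
-- since by uniqueness the other letters are distant from 0; now 1 is in front and can rotate.
Step-0∷map-suc (u∌0 ∷ _) (rotation (rotate zero u)) =
  rotation (rotate zero (suc zero ∷ map suc u)) ◅
  subst (λ v → Star Step (suc zero ∷ map suc u ++ [ zero ]) (suc zero ∷ zero ∷ v)) (++-identityʳ (map suc u))
    (commute-past-* [ suc zero ] (map suc u) [] (All.map⁺ (All.map (λ {i} → far {i = i}) u∌0))) ◅◅
  rotation (rotate (suc zero) (zero ∷ map suc u)) ◅
  subst (λ v → Star Step (zero ∷ map suc u ++ [ suc zero ]) (zero ∷ v)) (sym (map-++ suc u [ zero ])) ε
  where
  far : ∀ {m} {i : Fin (suc m)} → zero ≢ i → Distant {suc (suc m)} zero (suc i)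
  far {i = zero}  0≢0 = contradiction refl 0≢0
  far {i = suc i} _   = s≤s (s≤s z≤n)

Step*-map-suc : {u v : Word n} → Star Step u v → Star Step (map suc u) (map suc v)
Step*-map-suc ε        = ε
Step*-map-suc (s ◅ ss) = Step-map-suc s ◅ Step*-map-suc ss

Step*-0∷map-suc : {u v : Word n} → Unique u → Star Step u v →
  Star Step (zero ∷ map suc u) (zero ∷ map suc v)
Step*-0∷map-suc uniq ε        = ε
Step*-0∷map-suc uniq (s ◅ ss) =
  Step-0∷map-suc uniq s ◅◅ Step*-0∷map-suc (Unique-resp-↭ (Step⇒↭ s) uniq) ss

-- A subset of the letters is a Boolean function on ℕ, vanishing from n on.

sorted : ∀ n → (ℕ → Bool) → Word n
sorted zero    S = []
sorted (suc n) S =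
  if S 0 then zero ∷ map suc (sorted n (S ∘ suc)) else map suc (sorted n (S ∘ suc))

HasLetters : (ℕ → Bool) → Word n → Set
HasLetters S u = ∀ i → i ∈ u ⇔ S (toℕ i) ≡ true

desuc : ∀ (u : Word (suc n)) → zero ∉ u → ∃ λ v → u ≡ map suc v
desuc []          _   = [] , refl
desuc (zero ∷ u)  0∉u = contradiction (here refl) 0∉u
desuc (suc i ∷ u) 0∉u with v , refl ← desuc u (0∉u ∘ there) = i ∷ v , refl

-- The equivalence is a hypothesis because the shifted word is either `u` itself or what is left of
-- `u` after its letter 0 is taken away.
HasLetters-desuc : ∀ {S : ℕ → Bool} {u : Word (suc n)} {v} → HasLetters S u →
  (∀ {i} → suc i ∈ u ⇔ suc i ∈ map suc v) → HasLetters (S ∘ suc) v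
HasLetters-desuc h eq i = mk⇔
  (λ i∈v → to (h (suc i)) (from eq (∈-map⁺ suc i∈v)))
  (λ Si → pred-∈ (∈-map⁻ suc (to eq (from (h (suc i)) Si))))
  where
  open Equivalence
  pred-∈ : ∀ {i : Fin n} {v} → (∃ λ j → j ∈ v × suc i ≡ Fin.suc j) → i ∈ v
  pred-∈ (_ , j∈v , refl) = j∈v

sort : ∀ n S {u : Word n} → Unique u → HasLetters S u → Star Step u (sorted n S)
sort zero    S {[]} _ _ = ε
sort (suc n) S {u} uniq h with S 0 in S0
... | false with v , refl ← desuc u (λ 0∈u → contradiction (trans (sym S0) (Equivalence.to (h zero) 0∈u)) λ ()) =
  Step*-map-suc (sort n (S ∘ suc) (Unique.map⁻ uniq) (HasLetters-desuc {S = S} h (mk⇔ id id)))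
-- The unique letter 0 is rotated to the front; the remaining word is a shifted one.
... | true
    with x , y , refl ← ∈-∃++ (Equivalence.from (h zero) S0)
    with uniq′@(0∉ ∷ uniq″) ← Unique-resp-↭ (++-↭-comm x (zero ∷ y)) uniq
    with v , yx≡ ← desuc (y ++ x) (λ 0∈ → All.lookup 0∉ 0∈ refl) =
  rotations (Rotation-++ x (zero ∷ y)) ◅◅ subst (λ v → Star Step (zero ∷ v) _) (sym yx≡)
    (Step*-0∷map-suc uniq-v (sort n (S ∘ suc) uniq-v
      (HasLetters-desuc {S = S} h (mk⇔
        (λ i∈ → tail (∈-resp-↭ perm i∈))
        (λ i∈ → ∈-resp-↭ (↭-sym perm) (there i∈))))))
  where
  rotations : {u v : Word (suc n)} → Star Rotation u v → Star Step u v
  rotations ε        = ε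
  rotations (r ◅ rs) = rotation r ◅ rotations rs
  uniq-v = Unique.map⁻ (subst Unique yx≡ uniq″)
  perm : x ++ zero ∷ y ↭ zero ∷ map suc v
  perm = subst (λ v → x ++ zero ∷ y ↭ zero ∷ v) yx≡ (++-↭-comm x (zero ∷ y))
  tail : ∀ {i : Fin n} {w} → suc i ∈ zero ∷ w → suc i ∈ w
  tail (there p) = p


-- Conjugacy as intertwining

Conj : Word n → Word n → Set
Conj x y = ∃[ g ] g ++ x ≈ y ++ g

Conj-sym : {x y : Word n} → Conj x y → Conj y x
Conj-sym {x = x} {y} (g , gx≈yg) = reverse g , (begin
  g⁻¹ ++ y                  ≡⟨ cong (g⁻¹ ++_) (++-identityʳ y) ⟨
  g⁻¹ ++ y ++ []            ≈⟨ ++-congˡ g⁻¹ (++-congˡ y (reverse-inverseʳ g)) ⟨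
  g⁻¹ ++ y ++ g ++ g⁻¹      ≡⟨ cong (g⁻¹ ++_) (++-assoc y g g⁻¹) ⟨
  g⁻¹ ++ (y ++ g) ++ g⁻¹    ≈⟨ ++-congˡ g⁻¹ (++-congʳ g⁻¹ gx≈yg) ⟨
  g⁻¹ ++ (g ++ x) ++ g⁻¹    ≡⟨ cong (g⁻¹ ++_) (++-assoc g x g⁻¹) ⟩
  g⁻¹ ++ g ++ x ++ g⁻¹      ≡⟨ ++-assoc g⁻¹ g _ ⟨
  (g⁻¹ ++ g) ++ x ++ g⁻¹    ≈⟨ ++-congʳ (x ++ g⁻¹) (reverse-inverseˡ g) ⟩
  x ++ g⁻¹                  ∎)
  where
  open ≈-Reasoning
  g⁻¹ = reverse g

Conj-trans : {x y z : Word n} → Conj x y → Conj y z → Conj x z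
Conj-trans {x = x} {y} {z} (g , p) (h , q) = h ++ g , (begin
  (h ++ g) ++ x ≡⟨ ++-assoc h g x ⟩
  h ++ g ++ x   ≈⟨ ++-congˡ h p ⟩
  h ++ y ++ g   ≡⟨ ++-assoc h y g ⟨
  (h ++ y) ++ g ≈⟨ ++-congʳ g q ⟩
  (z ++ h) ++ g ≡⟨ ++-assoc z h g ⟩
  z ++ h ++ g   ∎)
  where open ≈-Reasoning

≈⇒Conj : {x y : Word n} → x ≈ y → Conj x y
≈⇒Conj {y = y} p = [] , ≈-trans p (≈-reflexive (sym (++-identityʳ y)))

Conjugate⇔Conj : {x y : Word n} → Conjugate (W-A n) x y ⇔ Conj x y
Conjugate⇔Conj {x = x} {y} = mk⇔
  (λ { (g , p) → g , ≈-sym (begin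
    y ++ g                        ≈⟨ ++-congʳ g p ⟩
    ((g ++ x) ++ reverse g) ++ g  ≡⟨ ++-assoc (g ++ x) (reverse g) g ⟩
    (g ++ x) ++ reverse g ++ g    ≈⟨ ++-congˡ (g ++ x) (reverse-inverseˡ g) ⟩
    (g ++ x) ++ []                ≡⟨ ++-identityʳ (g ++ x) ⟩
    g ++ x                        ∎) })
  (λ { (g , p) → g , (begin
    y                       ≡⟨ ++-identityʳ y ⟨
    y ++ []                 ≈⟨ ++-congˡ y (reverse-inverseʳ g) ⟨
    y ++ g ++ reverse g     ≡⟨ ++-assoc y g (reverse g) ⟨
    (y ++ g) ++ reverse g   ≈⟨ ++-congʳ (reverse g) p ⟨
    (g ++ x) ++ reverse g   ∎) })
  where open ≈-Reasoning

Step⇒Conj : {u v : Word n} → Step u v → Conj u v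
Step⇒Conj (rotation (rotate i u)) = [ i ] , (begin
  i ∷ i ∷ u          ≈⟨ ++-congʳ u (square i) ⟩
  u                  ≡⟨ ++-identityʳ u ⟨
  u ++ []            ≈⟨ ++-congˡ u (square i) ⟨
  u ++ i ∷ i ∷ []    ≡⟨ ++-assoc u [ i ] [ i ] ⟨
  (u ∷ʳ i) ++ [ i ]  ∎)
  where open ≈-Reasoning
Step⇒Conj (commutation (swap p q d)) = ≈⇒Conj (++-congˡ p (++-congʳ q (commute d)))

Step*⇒Conj : {u v : Word n} → Star Step u v → Conj u v
Step*⇒Conj ε        = ≈⇒Conj ≈-refl
Step*⇒Conj (s ◅ ss) = Conj-trans (Step⇒Conj s) (Step*⇒Conj ss)

-- The faithful action on ℕ in which s_{i+1} exchanges i and i + 1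

exchange : ℕ → ℕ → ℕ
exchange zero    zero          = 1
exchange zero    (suc zero)    = 0
exchange zero    (suc (suc p)) = suc (suc p)
exchange (suc i) zero          = zero
exchange (suc i) (suc p)       = suc (exchange i p)

act : Word n → ℕ → ℕ
act []      p = p
act (i ∷ u) p = exchange (toℕ i) (act u p)

act-++ : ∀ (u v : Word n) p → act (u ++ v) p ≡ act u (act v p)
act-++ []      v p = refl
act-++ (i ∷ u) v p = cong (exchange (toℕ i)) (act-++ u v p)

act-map-suc-zero : ∀ (u : Word n) → act (map suc u) 0 ≡ 0
act-map-suc-zero []      = refl
act-map-suc-zero (i ∷ u) = cong (exchange (suc (toℕ i))) (act-map-suc-zero u)

act-map-suc-suc : ∀ (u : Word n) p → act (map suc u) (suc p) ≡ suc (act u p)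
act-map-suc-suc []      p = refl
act-map-suc-suc (i ∷ u) p = cong (exchange (suc (toℕ i))) (act-map-suc-suc u p)

exchange-involutive : ∀ i p → exchange i (exchange i p) ≡ p
exchange-involutive zero    zero          = refl
exchange-involutive zero    (suc zero)    = refl
exchange-involutive zero    (suc (suc p)) = refl
exchange-involutive (suc i) zero          = refl
exchange-involutive (suc i) (suc p)       = cong suc (exchange-involutive i p)

exchange-comm : ∀ i j p → ∣ i - j ∣ > 1 → exchange i (exchange j p) ≡ exchange j (exchange i p)
exchange-comm zero    zero          p             ()
exchange-comm zero    (suc zero)    p             (s≤s ())
exchange-comm zero    (suc (suc j)) zero          d = refl
exchange-comm zero    (suc (suc j)) (suc zero)    d = refl
exchange-comm zero    (suc (suc j)) (suc (suc p)) d = refl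
exchange-comm (suc zero)    zero    p             (s≤s ())
exchange-comm (suc (suc i)) zero    zero          d = refl
exchange-comm (suc (suc i)) zero    (suc zero)    d = refl
exchange-comm (suc (suc i)) zero    (suc (suc p)) d = refl
exchange-comm (suc i) (suc j)       zero          d = refl
exchange-comm (suc i) (suc j)       (suc p)       d = cong suc (exchange-comm i j p d)

exchange-braid : ∀ i j p → ∣ i - j ∣ ≡ 1 →
  exchange i (exchange j (exchange i p)) ≡ exchange j (exchange i (exchange j p))
exchange-braid zero       (suc zero) zero                d = refl
exchange-braid zero       (suc zero) (suc zero)          d = refl
exchange-braid zero       (suc zero) (suc (suc zero))    d = refl
exchange-braid zero       (suc zero) (suc (suc (suc p))) d = refl
exchange-braid (suc zero) zero       zero                d = refl
exchange-braid (suc zero) zero       (suc zero)          d = refl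
exchange-braid (suc zero) zero       (suc (suc zero))    d = refl
exchange-braid (suc zero) zero       (suc (suc (suc p))) d = refl
exchange-braid (suc i)    (suc j)    zero                d = refl
exchange-braid (suc i)    (suc j)    (suc p)             d = cong suc (exchange-braid i j p d)

act-cong : {u v : Word n} → u ≈ v → ∀ p → act u p ≡ act v p
act-cong (square i)            p = exchange-involutive (toℕ i) p
act-cong (commute {i} {j} d)   p = exchange-comm (toℕ i) (toℕ j) p d
act-cong (braid {i} {j} a)     p = exchange-braid (toℕ i) (toℕ j) p a
act-cong (++-cong {u} {u′} {v} {v′} r s) p = begin
  act (u ++ v) p     ≡⟨ act-++ u v p ⟩
  act u (act v p)    ≡⟨ act-cong r _ ⟩
  act u′ (act v p)   ≡⟨ cong (act u′) (act-cong s p) ⟩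
  act u′ (act v′ p)  ≡⟨ act-++ u′ v′ p ⟨
  act (u′ ++ v′) p   ∎
  where open ≡-Reasoning
act-cong ≈-refl        p = refl
act-cong (≈-sym r)     p = sym (act-cong r p)
act-cong (≈-trans r s) p = trans (act-cong r p) (act-cong s p)

act-inverseˡ : ∀ (u : Word n) p → act (reverse u) (act u p) ≡ p
act-inverseˡ u p = trans (sym (act-++ (reverse u) u p)) (act-cong (reverse-inverseˡ u) p)

act-inverseʳ : ∀ (u : Word n) p → act u (act (reverse u) p) ≡ p
act-inverseʳ u p = trans (sym (act-++ u (reverse u) p)) (act-cong (reverse-inverseʳ u) p)

act-injective : ∀ (u : Word n) {p q} → act u p ≡ act u q → p ≡ q
act-injective u {p} {q} eq =
  trans (sym (act-inverseˡ u p)) (trans (cong (act (reverse u)) eq) (act-inverseˡ u q))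

exchange-≤ : ∀ {i p n} → i < n → p ≤ n → exchange i p ≤ n
exchange-≤ {zero}  {zero}        i<n p≤n = i<n
exchange-≤ {zero}  {suc zero}    i<n p≤n = z≤n
exchange-≤ {zero}  {suc (suc p)} i<n p≤n = p≤n
exchange-≤ {suc i} {zero}        i<n p≤n = z≤n
exchange-≤ {suc i} {suc p} (s≤s i<n) (s≤s p≤n) = s≤s (exchange-≤ i<n p≤n)

act-≤ : ∀ (u : Word n) {p} → p ≤ n → act u p ≤ n
act-≤ []      p≤n = p≤n
act-≤ (i ∷ u) p≤n = exchange-≤ (toℕ<n i) (act-≤ u p≤n)

-- The words s₁⋯s_k represent the cosets of the subgroup generated by s₂, …, sₙ.

coset : Fin (suc n) → Word n
coset         zero    = []
coset {suc n} (suc k) = zero ∷ map suc (coset k)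

-- Distinguishes the cosets: each is recognised by the point that its elements send to 0.
act-coset : ∀ (k : Fin (suc n)) → act (coset k) (toℕ k) ≡ 0
act-coset         zero    = refl
act-coset {suc n} (suc k) =
  cong (exchange 0) (trans (act-map-suc-suc (coset k) (toℕ k)) (cong suc (act-coset k)))

0-distant : ∀ (u : Word n) → All (Distant zero) (map suc (map suc u))
0-distant []      = []
0-distant (i ∷ u) = s≤s (s≤s z≤n) ∷ 0-distant u

-- A new letter 0 starts a representative, cancels against a lone 0, or moves left to the front and
-- braids with 0 and 1, leaving a letter 1 on the left. When `k` and `j` are both positive, the tail
-- is treated one rank lower, and the word that this produces on the left is distant from 0 and
-- passes it.
coset-∷ʳ : ∀ (k : Fin (suc (suc n))) (j : Fin (suc n)) →
  ∃₂ λ w l → coset k ∷ʳ j ≈ map suc w ++ coset l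
coset-∷ʳ         zero          zero    = [] , suc zero , ≈-refl
coset-∷ʳ         zero          (suc j) = [ j ] , zero , ≈-refl
coset-∷ʳ         (suc zero)    zero    = [] , zero , square zero
coset-∷ʳ {suc n} (suc (suc k)) zero    = [ zero ] , suc (suc k) , (begin
  zero ∷ suc zero ∷ y ∷ʳ zero    ≈⟨ ++-congˡ (zero ∷ suc zero ∷ []) (commute-past (0-distant (coset k))) ⟨
  zero ∷ suc zero ∷ zero ∷ y     ≈⟨ ++-congʳ y (braid refl) ⟩
  suc zero ∷ zero ∷ suc zero ∷ y ∎)
  where
  open ≈-Reasoning
  y = map suc (map suc (coset k))
coset-∷ʳ {suc n} (suc k)       (suc j) with w , l , eq ← coset-∷ʳ k j =
  map suc w , suc l , (begin
    zero ∷ map suc (coset k) ∷ʳ suc j                ≡⟨ cong (zero ∷_) (map-++ suc (coset k) [ j ]) ⟨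
    zero ∷ map suc (coset k ∷ʳ j)                    ≈⟨ ++-congˡ [ zero ] (map-suc-cong eq) ⟩
    zero ∷ map suc (map suc w ++ coset l)            ≡⟨ cong (zero ∷_) (map-++ suc (map suc w) (coset l)) ⟩
    zero ∷ map suc (map suc w) ++ map suc (coset l)  ≈⟨ commute-past-++ _ (0-distant w) ⟩
    map suc (map suc w) ++ zero ∷ map suc (coset l)  ∎)
  where open ≈-Reasoning

coset-++ : ∀ (k : Fin (suc (suc n))) u → ∃₂ λ w l → coset k ++ u ≈ map suc w ++ coset l
coset-++ k []      = [] , k , ≈-reflexive (++-identityʳ (coset k))
coset-++ k (j ∷ u)
  with w , l , eq ← coset-∷ʳ k j
  with w′ , l′ , eq′ ← coset-++ l u = w ++ w′ , l′ , (begin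
    coset k ++ j ∷ u                    ≡⟨ ++-assoc (coset k) [ j ] u ⟨
    (coset k ∷ʳ j) ++ u                 ≈⟨ ++-congʳ u eq ⟩
    (map suc w ++ coset l) ++ u         ≡⟨ ++-assoc (map suc w) (coset l) u ⟩
    map suc w ++ coset l ++ u           ≈⟨ ++-congˡ (map suc w) eq′ ⟩
    map suc w ++ map suc w′ ++ coset l′ ≡⟨ ++-assoc (map suc w) (map suc w′) (coset l′) ⟨
    (map suc w ++ map suc w′) ++ coset l′ ≡⟨ cong (_++ coset l′) (map-++ suc w w′) ⟨
    map suc (w ++ w′) ++ coset l′       ∎)
  where open ≈-Reasoning

act-map-suc-++-coset : ∀ (w : Word n) l → act (map suc w ++ coset l) (toℕ l) ≡ 0
act-map-suc-++-coset w l = trans (act-++ (map suc w) (coset l) (toℕ l))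
  (trans (cong (act (map suc w)) (act-coset l)) (act-map-suc-zero w))

-- Written as an element of the subgroup times a representative, `u` sends `l` to 0. Acting
-- trivially it forces `l` to be 0, so `u` lies in the subgroup, and the induction continues one
-- rank lower.
act-trivial : ∀ n (u : Word n) → (∀ p → act u p ≡ p) → u ≈ []
act-trivial zero    []       _   = ≈-refl
act-trivial (suc n) u        triv
  with w , l , eq ← coset-++ zero u
  with refl ← toℕ-injective {i = l} {zero} (trans (sym (triv (toℕ l)))
                (trans (act-cong eq (toℕ l)) (act-map-suc-++-coset w l)))
  = ≈-trans u≈w (map-suc-cong (act-trivial n w λ p → suc-injective (begin
      suc (act w p)           ≡⟨ act-map-suc-suc w p ⟨
      act (map suc w) (suc p) ≡⟨ act-cong u≈w (suc p) ⟨
      act u (suc p)           ≡⟨ triv (suc p) ⟩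
      suc p                   ∎)))
  where
  open ≡-Reasoning
  u≈w = ≈-trans eq (≈-reflexive (++-identityʳ (map suc w)))

act-faithful : {u v : Word n} → (∀ p → act u p ≡ act v p) → u ≈ v
act-faithful {n} {u} {v} eq = begin
  u                      ≡⟨ ++-identityʳ u ⟨
  u ++ []                ≈⟨ ++-congˡ u (reverse-inverseˡ v) ⟨
  u ++ reverse v ++ v    ≡⟨ ++-assoc u (reverse v) v ⟨
  (u ++ reverse v) ++ v  ≈⟨ ++-congʳ v (act-trivial n (u ++ reverse v) λ p →
                              trans (act-++ u (reverse v) p)
                                    (trans (eq _) (act-inverseʳ v p))) ⟩
  v                      ∎
  where open ≈-Reasoning

-- The blocks of a subset: the intervals of points joined by its letters

Bounded : ℕ → (ℕ → Bool) → Set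
Bounded n S = ∀ {i} → S i ≡ true → i < n

-- The least point of the block of `p`, used as the canonical name of the block.
blockStart : (ℕ → Bool) → ℕ → ℕ
blockStart S zero    = zero
blockStart S (suc p) = if S p then blockStart S p else suc p

-- The first argument bounds the length that can be counted.
runLength : ℕ → (ℕ → Bool) → ℕ → ℕ
runLength zero    S k = 0
runLength (suc f) S k = if S k then suc (runLength f S (suc k)) else 0

-- The second condition excludes one-point blocks, which carry no letter and hence correspond to no
-- chunk.
IsStart : (ℕ → Bool) → ℕ → Set
IsStart S k = blockStart S k ≡ k × S k ≡ true

isStart? : ∀ S → Decidable (IsStart S)
isStart? S k = (blockStart S k ≟ k) ×-dec (S k Bool.≟ true)

module _ {S : ℕ → Bool} where

  blockStart-suc : ∀ {p} → S p ≡ true → blockStart S (suc p) ≡ blockStart S p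
  blockStart-suc Sp rewrite Sp = refl

  blockStart-≤ : ∀ p → blockStart S p ≤ p
  blockStart-≤ zero    = z≤n
  blockStart-≤ (suc p) with S p
  ... | true  = m≤n⇒m≤1+n (blockStart-≤ p)
  ... | false = ≤-refl

  blockStart-idem : ∀ p → blockStart S (blockStart S p) ≡ blockStart S p
  blockStart-idem zero    = refl
  blockStart-idem (suc p) with S p in Sp
  ... | true                = blockStart-idem p
  ... | false rewrite Sp    = refl

  blockStart+offset : ∀ p → blockStart S p + (p ∸ blockStart S p) ≡ p
  blockStart+offset p = m+[n∸m]≡n (blockStart-≤ p)

  within-block : ∀ {p j} → blockStart S p ≤ j → j < p → S j ≡ true
  within-block {suc p} {j} s≤j j<1+p with S p in Sp
  ... | false = contradiction j<1+p (≤⇒≯ s≤j)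
  ... | true with m<1+n⇒m<n∨m≡n j<1+p
  ...   | inj₁ j<p  = within-block s≤j j<p
  ...   | inj₂ refl = Sp

  run-letters : ∀ f k t → t < runLength f S k → S (k + t) ≡ true
  run-letters (suc f) k t t< with S k in Sk
  run-letters (suc f) k zero    _        | true = trans (cong S (+-identityʳ k)) Sk
  run-letters (suc f) k (suc t) (s≤s t<) | true =
    trans (cong S (+-suc k t)) (run-letters f (suc k) t t<)

  -- No letter from `n` on is present, so with `n ≤ k + f` it is a missing letter that ends the
  -- count and not the bound `f`.
  run-end : Bounded n S → ∀ f k → n ≤ k + f → S (k + runLength f S k) ≡ false
  run-end bd zero    k n≤ with S (k + 0) in Sk
  ... | true  = contradiction (bd Sk) (≤⇒≯ n≤)
  ... | false = refl
  run-end {n} bd (suc f) k n≤ with S k in Sk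
  ... | true  = trans (cong S (+-suc k (runLength f S (suc k))))
                      (run-end bd f (suc k) (subst (n ≤_) (+-suc k f) n≤))
  ... | false = trans (cong S (+-identityʳ k)) Sk

  blockStart-run : ∀ f {k} t → blockStart S k ≡ k → t ≤ runLength f S k → blockStart S (k + t) ≡ k
  blockStart-run f {k} zero    st _  = trans (cong (blockStart S) (+-identityʳ k)) st
  blockStart-run f {k} (suc t) st t< = begin
    blockStart S (k + suc t)   ≡⟨ cong (blockStart S) (+-suc k t) ⟩
    blockStart S (suc (k + t)) ≡⟨ blockStart-suc (run-letters f k t t<) ⟩
    blockStart S (k + t)       ≡⟨ blockStart-run f t st (<⇒≤ t<) ⟩
    k                          ∎
    where open ≡-Reasoning

  ≤-block-end : Bounded n S → ∀ p → p ≤ blockStart S p + runLength n S (blockStart S p)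
  ≤-block-end {n} bd p = ≮⇒≥ λ end<p → contradiction
    (trans (sym (within-block (m≤m+n _ _) end<p)) (run-end bd n (blockStart S p) (m≤n+m n _))) λ ()

  -- The bound is attained: a block with `r` letters has `r + 1` points.
  offset-≤ : Bounded n S → ∀ p → p ∸ blockStart S p ≤ runLength n S (blockStart S p)
  offset-≤ bd p = m≤n+o⇒m∸n≤o p (blockStart S p) (≤-block-end bd p)

  run>0 : ∀ n {k} → 0 < runLength n S k → S k ≡ true
  run>0 n {k} 0< = trans (cong S (sym (+-identityʳ k))) (run-letters n k 0 0<)

  start⇒run>0 : ∀ {n} → Bounded n S → ∀ {k} → S k ≡ true → 0 < runLength n S k
  start⇒run>0 {zero}  bd Sk = contradiction (bd Sk) λ ()
  start⇒run>0 {suc n} bd Sk rewrite Sk = s≤s z≤n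

  start-letter : ∀ {p} → S p ≡ true → S (blockStart S p) ≡ true
  start-letter {p} Sp with m≤n⇒m<n∨m≡n (blockStart-≤ p)
  ... | inj₁ s<p = within-block ≤-refl s<p
  ... | inj₂ s≡p = trans (cong S s≡p) Sp

  -- If the least point of a block carries no letter, nothing joins it to the next point and the
  -- block is a singleton.
  blockStart-letter : ∀ {p} → S (blockStart S p) ≡ false → blockStart S p ≡ p
  blockStart-letter {zero}  _ = refl
  blockStart-letter {suc p} with S p in Sp
  ... | false = λ _ → refl
  ... | true  = λ eq → contradiction (trans (sym eq) (start-letter Sp)) λ ()

-- On every block the sorted product moves each point up, and the last one to the start.

-- A letter 0 only merges the point 0 into the block that starts at 1. Since `exchange 0` sends 1 to
-- 0 and fixes all larger starts, this form matches the action of the first letter of the sorted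
-- product.
blockStart-tail : ∀ S p → blockStart S (suc p) ≡
  (if S 0 then exchange 0 (suc (blockStart (S ∘ suc) p)) else suc (blockStart (S ∘ suc) p))
blockStart-tail S zero with S 0
... | true  = refl
... | false = refl
blockStart-tail S (suc p) with S (suc p)
... | true  = blockStart-tail S p
... | false with S 0
...   | true  = refl
...   | false = refl

-- A word acts from its right end, here with the largest letters first: those above `p` fix `p`, the
-- letter `p` moves it up, and the smaller ones fix `p + 1`.
act-sorted-suc : ∀ n {S p} → Bounded n S → S p ≡ true → act (sorted n S) p ≡ suc p
act-sorted-suc zero          bd Sp = contradiction (bd Sp) λ ()
act-sorted-suc (suc n) {S} {zero} bd Sp rewrite Sp =
  cong (exchange 0) (act-map-suc-zero (sorted n (S ∘ suc)))
act-sorted-suc (suc n) {S} {suc p} bd Sp with S 0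
... | false = trans (act-map-suc-suc (sorted n (S ∘ suc)) p)
                    (cong suc (act-sorted-suc n (s≤s⁻¹ ∘ bd) Sp))
... | true  = cong (exchange 0) (trans (act-map-suc-suc (sorted n (S ∘ suc)) p)
                    (cong suc (act-sorted-suc n (s≤s⁻¹ ∘ bd) Sp)))

-- Here `p` is the last point of its block. The letters `p - 1`, `p - 2`, and so on carry it down
-- one place each until one of them is missing.
act-sorted-end : ∀ n {S p} → Bounded n S → S p ≡ false → act (sorted n S) p ≡ blockStart S p
act-sorted-end zero {S} {zero}  bd Sp = refl
act-sorted-end zero {S} {suc p} bd Sp with S p in eq
... | true  = contradiction (bd eq) λ ()
... | false = refl
act-sorted-end (suc n) {S} {zero}  bd Sp rewrite Sp = act-map-suc-zero (sorted n (S ∘ suc))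
act-sorted-end (suc n) {S} {suc p} bd Sp = trans step (sym (blockStart-tail S p))
  where
  ih : act (map suc (sorted n (S ∘ suc))) (suc p) ≡ suc (blockStart (S ∘ suc) p)
  ih = trans (act-map-suc-suc (sorted n (S ∘ suc)) p)
             (cong suc (act-sorted-end n (s≤s⁻¹ ∘ bd) Sp))
  step : act (sorted (suc n) S) (suc p) ≡
    (if S 0 then exchange 0 (suc (blockStart (S ∘ suc) p)) else suc (blockStart (S ∘ suc) p))
  step with S 0
  ... | true  = cong (exchange 0) ih
  ... | false = ih

blockStart-act : ∀ {S} → Bounded n S → ∀ p → blockStart S (act (sorted n S) p) ≡ blockStart S p
blockStart-act {S = S} bd p with S p in Sp
... | true  = trans (cong (blockStart S) (act-sorted-suc _ bd Sp)) (blockStart-suc {S} Sp)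
... | false = trans (cong (blockStart S) (act-sorted-end _ bd Sp)) (blockStart-idem p)

-- The maps are total on points and constrained at block starts only, so that they carry no proofs;
-- nontrivial blocks are represented by their least points.
record BlockBijection (n : ℕ) (S T : ℕ → Bool) : Set where
  field
    to from    : ℕ → ℕ
    to-start   : ∀ {k} → IsStart S k → IsStart T (to k)
    from-start : ∀ {l} → IsStart T l → IsStart S (from l)
    to-run     : ∀ {k} → IsStart S k → runLength n T (to k) ≡ runLength n S k
    from-to    : ∀ {k} → IsStart S k → from (to k) ≡ k
    to-from    : ∀ {l} → IsStart T l → to (from l) ≡ l

-- Conjugating elements map blocks onto blocks

module _ {S T : ℕ → Bool} (bS : Bounded n S) (bT : Bounded n T) where

  intertwine-act : ((g , _) : Conj (sorted n S) (sorted n T)) → ∀ p →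
    act g (act (sorted n S) p) ≡ act (sorted n T) (act g p)
  intertwine-act (g , eq) p = begin
    act g (act (sorted n S) p) ≡⟨ act-++ g (sorted n S) p ⟨
    act (g ++ sorted n S) p    ≡⟨ act-cong eq p ⟩
    act (sorted n T ++ g) p    ≡⟨ act-++ (sorted n T) g p ⟩
    act (sorted n T) (act g p) ∎
    where open ≡-Reasoning

  -- Neighbouring points of a block are linked by the product over `S`. The conjugator turns this
  -- link into one by the product over `T`, which never leaves a block.
  act-block : ((g , _) : Conj (sorted n S) (sorted n T)) → ∀ p →
    blockStart T (act g (blockStart S p)) ≡ blockStart T (act g p)
  act-block c zero = refl
  act-block c@(g , _) (suc p) with S p in Sp
  ... | false = refl
  ... | true  = begin
    blockStart T (act g (blockStart S p))        ≡⟨ act-block c p ⟩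
    blockStart T (act g p)                       ≡⟨ blockStart-act bT (act g p) ⟨
    blockStart T (act (sorted n T) (act g p))    ≡⟨ cong (blockStart T) (intertwine-act c p) ⟨
    blockStart T (act g (act (sorted n S) p))    ≡⟨ cong (blockStart T ∘ act g) (act-sorted-suc n bS Sp) ⟩
    blockStart T (act g (suc p))                 ∎
    where open ≡-Reasoning

  -- The conjugator injects the points of one block into those of the other. Points outnumber
  -- letters by one on both sides, hence the `suc` in both index types.
  act-run-≤ : ((g , _) : Conj (sorted n S) (sorted n T)) → ∀ {k} → blockStart S k ≡ k →
    runLength n S k ≤ runLength n T (blockStart T (act g k))
  act-run-≤ c@(g , _) {k} st = s≤s⁻¹ (injective⇒≤ {f = offset} offset-injective)
    where
    l = blockStart T (act g k)
    point : Fin (suc (runLength n S k)) → ℕ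
    point e = act g (k + toℕ e)
    point-block : ∀ e → blockStart T (point e) ≡ l
    point-block e = trans (sym (act-block c (k + toℕ e)))
      (cong (blockStart T ∘ act g) (blockStart-run n (toℕ e) st (s≤s⁻¹ (toℕ<n e))))
    offset< : ∀ e → point e ∸ l < suc (runLength n T l)
    offset< e = s≤s (subst (λ l → point e ∸ l ≤ runLength n T l) (point-block e)
                      (offset-≤ bT (point e)))
    offset : Fin (suc (runLength n S k)) → Fin (suc (runLength n T l))
    offset e = fromℕ< (offset< e)
    l≤point : ∀ e → l ≤ point e
    l≤point e = subst (_≤ point e) (point-block e) (blockStart-≤ (point e))
    offset-injective : ∀ {d e} → offset d ≡ offset e → d ≡ e
    offset-injective {d} {e} eq = toℕ-injective (+-cancelˡ-≡ k _ _ (act-injective g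
      (∸-cancelʳ-≡ (l≤point d) (l≤point e)
        (trans (sym (toℕ-fromℕ< (offset< d))) (trans (cong toℕ eq) (toℕ-fromℕ< (offset< e)))))))

module _ {S T : ℕ → Bool} (bS : Bounded n S) (bT : Bounded n T) where

  act-blockStart-inverse : (c : Conj (sorted n S) (sorted n T)) → ∀ {k} → blockStart S k ≡ k →
    blockStart S (act (reverse (proj₁ c)) (blockStart T (act (proj₁ c) k))) ≡ k
  act-blockStart-inverse c@(g , _) {k} st =
    trans (act-block bT bS (Conj-sym c) (act g k))
          (trans (cong (blockStart S) (act-inverseˡ g k)) st)

  act-run : (c : Conj (sorted n S) (sorted n T)) → ∀ {k} → blockStart S k ≡ k →
    runLength n T (blockStart T (act (proj₁ c) k)) ≡ runLength n S k
  act-run c@(g , _) {k} st = ≤-antisym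
    (subst (λ j → runLength n T (blockStart T (act g k)) ≤ runLength n S j)
       (act-blockStart-inverse c st)
       (act-run-≤ bT bS (Conj-sym c) (blockStart-idem (act g k))))
    (act-run-≤ bS bT c st)

  act-start : (c : Conj (sorted n S) (sorted n T)) → ∀ {k} → IsStart S k →
    IsStart T (blockStart T (act (proj₁ c) k))
  act-start c@(g , _) {k} (st , Sk) = blockStart-idem (act g k) ,
    run>0 n (subst (0 <_) (sym (act-run c st)) (start⇒run>0 bS Sk))

Conj⇒BlockBijection : ∀ {S T} → Bounded n S → Bounded n T →
  Conj (sorted n S) (sorted n T) → BlockBijection n S T
Conj⇒BlockBijection {S = S} {T} bS bT c@(g , _) = record
  { to         = λ k → blockStart T (act g k)
  ; from       = λ l → blockStart S (act (reverse g) l)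
  ; to-start   = act-start bS bT c
  ; from-start = act-start bT bS (Conj-sym c)
  ; to-run     = act-run bS bT c ∘ proj₁
  ; from-to    = act-blockStart-inverse bS bT c ∘ proj₁
  ; to-from    = λ {l} (st , _) → trans (act-block bS bT c (act (reverse g) l))
                   (trans (cong (blockStart T) (act-inverseʳ g l)) st)
  }

-- A bijection of blocks is realised by a group element

exchange-lower : ∀ i → exchange i i ≡ suc i
exchange-lower zero    = refl
exchange-lower (suc i) = cong suc (exchange-lower i)

exchange-upper : ∀ i → exchange i (suc i) ≡ i
exchange-upper i = trans (cong (exchange i) (sym (exchange-lower i))) (exchange-involutive i i)

exchange-fixed : ∀ i {p} → p ≢ i → p ≢ suc i → exchange i p ≡ p
exchange-fixed zero    {zero}        p≢i _   = contradiction refl p≢i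
exchange-fixed zero    {suc zero}    _   p≢  = contradiction refl p≢
exchange-fixed zero    {suc (suc p)} _   _   = refl
exchange-fixed (suc i) {zero}        _   _   = refl
exchange-fixed (suc i) {suc p}       p≢i p≢  =
  cong suc (exchange-fixed i (p≢i ∘ cong suc) (p≢ ∘ cong suc))

Transposes : ℕ → ℕ → Word n → Set
Transposes a b t = act t a ≡ b × act t b ≡ a × (∀ {c} → c ≢ a → c ≢ b → act t c ≡ c)

-- Induction on the upper point: the transposition of `a` and `b + 1` is that of `a` and `b`
-- conjugated by the generator exchanging `b` and `b + 1`.
transposition-< : ∀ {a b} → a < b → b ≤ n → ∃ λ (t : Word n) → Transposes a b t
transposition-< {a = a} {suc b} a<1+b b<n with m<1+n⇒m<n∨m≡n a<1+b
... | inj₂ refl = [ fromℕ< b<n ] ,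
  subst (λ i → exchange i b ≡ suc b × exchange i (suc b) ≡ b ×
               (∀ {c} → c ≢ b → c ≢ suc b → exchange i c ≡ c))
    (sym (toℕ-fromℕ< b<n)) (exchange-lower b , exchange-upper b , exchange-fixed b)
... | inj₁ a<b with t , ta≡b , tb≡a , fixed ← transposition-< a<b (<⇒≤ b<n) =
  s ∷ t ∷ʳ s , conjugate a up , conjugate (suc b) down , λ {c} c≢a c≢1+b → conjugate c (other c≢a c≢1+b)
  where
  s = fromℕ< b<n
  e = exchange b
  conjugate : ∀ p {q} → e (act t (e p)) ≡ q → act (s ∷ t ∷ʳ s) p ≡ q
  conjugate p eq = trans (cong (exchange (toℕ s)) (act-++ t [ s ] p))
    (trans (cong (λ i → exchange i (act t (exchange i p))) (toℕ-fromℕ< b<n)) eq)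
  ea≡a : e a ≡ a
  ea≡a = exchange-fixed b (<⇒≢ a<b) (<⇒≢ a<1+b)
  up : e (act t (e a)) ≡ suc b
  up rewrite ea≡a | ta≡b = exchange-lower b
  down : e (act t (e (suc b))) ≡ a
  down rewrite exchange-upper b | tb≡a = ea≡a
  other : ∀ {c} → c ≢ a → c ≢ suc b → e (act t (e c)) ≡ c
  other {c} c≢a c≢1+b with c ≟ b
  ... | yes refl rewrite exchange-lower c
                       | fixed (≢-sym (<⇒≢ a<1+b)) (1+n≢n {c}) = exchange-upper c
  ... | no c≢b rewrite exchange-fixed b c≢b c≢1+b | fixed c≢a c≢b = exchange-fixed b c≢b c≢1+b

transposition : ∀ {a b} → a ≤ n → b ≤ n → ∃ λ (t : Word n) → Transposes a b t
transposition {a = a} {b} a≤n b≤n with <-cmp a b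
... | tri< a<b _ _  = transposition-< a<b b≤n
... | tri≈ _ refl _ = [] , refl , refl , λ _ _ → refl
... | tri> _ _ b<a with t , tb≡a , ta≡b , fixed ← transposition-< b<a a≤n =
  t , ta≡b , tb≡a , λ c≢a c≢b → fixed c≢b c≢a

-- The permutation is built point by point, correcting the image of `k` by a transposition on the
-- left. Earlier images stay put: they differ from the old image of `k` because `g` is injective,
-- and from `f k` because `f` is.
extend-injection : ∀ {p} {A : Pred ℕ p} → Decidable A → (f : ℕ → ℕ) →
  (∀ {a} → A a → f a ≤ n) → (∀ {a b} → A a → A b → f a ≡ f b → a ≡ b) →
  ∀ k → k ≤ suc n → ∃ λ (g : Word n) → ∀ {a} → a < k → A a → act g a ≡ f a
extend-injection A? f f≤n inj zero    _  = [] , λ ()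
extend-injection A? f f≤n inj (suc k) k<
  with g , g≡f ← extend-injection A? f f≤n inj k (<⇒≤ k<)
  with A? k
... | no ¬Ak = g , λ a<1+k Aa → case m<1+n⇒m<n∨m≡n a<1+k of λ where
  (inj₁ a<k)  → g≡f a<k Aa
  (inj₂ refl) → contradiction Aa ¬Ak
... | yes Ak with t , t-gk , _ , fixed ← transposition (act-≤ g (s≤s⁻¹ k<)) (f≤n Ak) =
  t ++ g , λ {a} a<1+k Aa → trans (act-++ t g a) (case m<1+n⇒m<n∨m≡n a<1+k of λ where
    (inj₁ a<k)  → trans (fixed (λ eq → <⇒≢ a<k (act-injective g eq))
                               (λ eq → <⇒≢ a<k (inj Aa Ak (trans (sym (g≡f a<k Aa)) eq))))
                        (g≡f a<k Aa)
    (inj₂ refl) → t-gk)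

module _ {S T} (bS : Bounded n S) (bT : Bounded n T) (B : BlockBijection n S T) where
  open BlockBijection B

  private
    InBlock : (ℕ → Bool) → ℕ → Set
    InBlock S p = IsStart S (blockStart S p)

    -- Translates every nontrivial block onto its partner. A translation keeps the order of the
    -- points, so it carries the cycle on one block to the cycle on the other.
    f : ℕ → ℕ
    f p = to (blockStart S p) + (p ∸ blockStart S p)

    f-offset-≤ : ∀ {p} → InBlock S p →
      p ∸ blockStart S p ≤ runLength n T (to (blockStart S p))
    f-offset-≤ {p} st = subst (_ ≤_) (sym (to-run st)) (offset-≤ bS p)

    f-blockStart : ∀ {p} → InBlock S p → blockStart T (f p) ≡ to (blockStart S p)
    f-blockStart {p} st = blockStart-run n _ (proj₁ (to-start st)) (f-offset-≤ {p} st)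

    f-injective : ∀ {p q} → InBlock S p → InBlock S q → f p ≡ f q → p ≡ q
    f-injective {p} {q} sp sq eq = begin
      p                                      ≡⟨ blockStart+offset p ⟨
      blockStart S p + (p ∸ blockStart S p)  ≡⟨ cong₂ _+_ starts offsets ⟩
      blockStart S q + (q ∸ blockStart S q)  ≡⟨ blockStart+offset q ⟩
      q                                      ∎
      where
      open ≡-Reasoning
      starts : blockStart S p ≡ blockStart S q
      starts = begin
        blockStart S p             ≡⟨ from-to sp ⟨
        from (to (blockStart S p)) ≡⟨ cong from (trans (sym (f-blockStart {p} sp)) (trans (cong (blockStart T) eq) (f-blockStart {q} sq))) ⟩
        from (to (blockStart S q)) ≡⟨ from-to sq ⟩
        blockStart S q             ∎
      offsets : p ∸ blockStart S p ≡ q ∸ blockStart S q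
      offsets = +-cancelˡ-≡ (to (blockStart S p)) _ _
        (trans eq (cong (λ k → to k + (q ∸ blockStart S q)) (sym starts)))

    f-suc : ∀ {p} → S p ≡ true → f (suc p) ≡ suc (f p)
    f-suc {p} Sp = begin
      f (suc p)                           ≡⟨ cong (λ k → to k + (suc p ∸ k)) (blockStart-suc {S} Sp) ⟩
      to k + (suc p ∸ k)                  ≡⟨ cong (to k +_) (+-∸-assoc 1 (blockStart-≤ {S} p)) ⟩
      to k + suc (p ∸ k)                  ≡⟨ +-suc (to k) (p ∸ k) ⟩
      suc (f p)                           ∎
      where
      open ≡-Reasoning
      k = blockStart S p

    letter⇒InBlock : ∀ {S p} → S p ≡ true → InBlock S p
    letter⇒InBlock {S} {p} Sp = blockStart-idem p , start-letter {S} Sp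

    ¬InBlock⇒fixed : ∀ {S p} → Bounded n S → ¬ InBlock S p → act (sorted n S) p ≡ p
    ¬InBlock⇒fixed {S} {p} bd ¬st with S p in Sp
    ... | true  = contradiction (letter⇒InBlock {S} Sp) ¬st
    ... | false = trans (act-sorted-end n bd Sp)
      (blockStart-letter (¬-not λ Sk → ¬st (blockStart-idem p , Sk)))

    -- When `p` is a letter, `p + 1` still lies in the block, so the offset of `p` is strictly below
    -- the run length, which `to-run` transfers to the image.
    f-letter : ∀ {p} → S p ≡ true → T (f p) ≡ true
    f-letter {p} Sp = run-letters n _ _ (begin-strict
      p ∸ k               <⟨ ∸-monoˡ-< (n<1+n p) (blockStart-≤ p) ⟩
      suc p ∸ k           ≡⟨ cong (suc p ∸_) (blockStart-suc {S} Sp) ⟨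
      suc p ∸ blockStart S (suc p) ≤⟨ offset-≤ bS (suc p) ⟩
      runLength n S (blockStart S (suc p)) ≡⟨ cong (runLength n S) (blockStart-suc {S} Sp) ⟩
      runLength n S k     ≡⟨ to-run (letter⇒InBlock {S} Sp) ⟨
      runLength n T (to k) ∎)
      where
      open ≤-Reasoning
      k = blockStart S p

    -- Now `p` is the last point: its offset equals the run length, and the image sits at the end of
    -- the run in `T`.
    f-¬letter : ∀ {p} → InBlock S p → S p ≡ false → T (f p) ≡ false
    f-¬letter {p} st ¬Sp = begin
      T (to k + (p ∸ k))             ≡⟨ cong (λ d → T (to k + d)) full ⟩
      T (to k + runLength n T (to k)) ≡⟨ run-end bT n (to k) (m≤n+m n (to k)) ⟩
      false                          ∎
      where
      open ≡-Reasoning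
      k = blockStart S p
      full : p ∸ k ≡ runLength n T (to k)
      full with m≤n⇒m<n∨m≡n (offset-≤ bS p)
      ... | inj₂ eq  = trans eq (sym (to-run st))
      ... | inj₁ lt  = contradiction (trans (sym ¬Sp)
                         (trans (cong S (sym (blockStart+offset p))) (run-letters n k _ lt))) λ ()

    f-intertwines : ∀ {p} → InBlock S p → act (sorted n T) (f p) ≡ f (act (sorted n S) p)
    f-intertwines {p} st with S p in Sp
    ... | true  = begin
      act (sorted n T) (f p) ≡⟨ act-sorted-suc n bT (f-letter Sp) ⟩
      suc (f p)              ≡⟨ f-suc Sp ⟨
      f (suc p)              ≡⟨ cong f (act-sorted-suc n bS Sp) ⟨
      f (act (sorted n S) p) ∎
      where open ≡-Reasoning
    ... | false = begin
      act (sorted n T) (f p)  ≡⟨ act-sorted-end n bT (f-¬letter st Sp) ⟩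
      blockStart T (f p)      ≡⟨ f-blockStart {p} st ⟩
      to k                    ≡⟨ +-identityʳ (to k) ⟨
      to k + 0                ≡⟨ cong (to k +_) (n∸n≡0 k) ⟨
      to k + (k ∸ k)          ≡⟨ cong (λ j → to j + (k ∸ j)) (blockStart-idem p) ⟨
      f k                     ≡⟨ cong f (act-sorted-end n bS Sp) ⟨
      f (act (sorted n S) p)  ∎
      where
      open ≡-Reasoning
      k = blockStart S p

    InBlock-act : ∀ {p} → InBlock S p → InBlock S (act (sorted n S) p)
    InBlock-act {p} = subst (IsStart S) (sym (blockStart-act bS p))

    point-≤ : ∀ {S p} → Bounded n S → InBlock S p → p ≤ n
    point-≤ {S} {p} bd (_ , Sk) with m≤n⇒m<n∨m≡n (blockStart-≤ {S} p)
    ... | inj₂ s≡p = <⇒≤ (subst (_< n) s≡p (bd Sk))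
    point-≤ {S} {suc p} bd _ | inj₁ s≤p = bd (within-block (s≤s⁻¹ s≤p) (n<1+n p))

    f-≤ : ∀ {p} → InBlock S p → f p ≤ n
    f-≤ {p} st = point-≤ bT (subst (IsStart T) (sym (f-blockStart {p} st)) (to-start st))

    InBlock? : ∀ S → Decidable (InBlock S)
    InBlock? S p = isStart? S (blockStart S p)

    -- The conjugator is controlled on nontrivial blocks only. Since these already fill the
    -- nontrivial blocks of `T`, injectivity keeps every other point outside them, where both
    -- products act as the identity.
    f-surjective : ∀ {q} → InBlock T q → ∃ λ p → InBlock S p × f p ≡ q
    f-surjective {q} st = p , st′ , trans (cong (λ k → to k + (p ∸ k)) start) (begin
      to (from l) + (p ∸ from l)  ≡⟨ cong₂ _+_ (to-from st) (m+n∸m≡n (from l) (q ∸ l)) ⟩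
      l + (q ∸ l)                 ≡⟨ blockStart+offset q ⟩
      q                           ∎)
      where
      open ≡-Reasoning
      l = blockStart T q
      p = from l + (q ∸ l)
      run-from : runLength n T l ≡ runLength n S (from l)
      run-from = trans (cong (runLength n T) (sym (to-from st))) (to-run (from-start st))
      start : blockStart S p ≡ from l
      start = blockStart-run n _ (proj₁ (from-start st)) (subst (_ ≤_) run-from (offset-≤ bT q))
      st′ : InBlock S p
      st′ = subst (IsStart S) (sym start) (from-start st)

  BlockBijection⇒Conj : Conj (sorted n S) (sorted n T)
  BlockBijection⇒Conj
    with g , g≡f ← extend-injection (InBlock? S) f (λ {p} → f-≤ {p}) (λ {p} {q} → f-injective {p} {q})
                     (suc n) ≤-refl =
    g , act-faithful λ p → trans (act-++ g (sorted n S) p)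
          (trans (intertwines p) (sym (act-++ (sorted n T) g p)))
    where
    agrees : ∀ p → InBlock S p → act g p ≡ f p
    agrees p st = g≡f (s≤s (point-≤ bS st)) st
    intertwines : ∀ p → act g (act (sorted n S) p) ≡ act (sorted n T) (act g p)
    intertwines p with InBlock? S p
    ... | yes st = begin
      act g (act (sorted n S) p) ≡⟨ agrees _ (InBlock-act {p} st) ⟩
      f (act (sorted n S) p)     ≡⟨ f-intertwines {p} st ⟨
      act (sorted n T) (f p)     ≡⟨ cong (act (sorted n T)) (agrees p st) ⟨
      act (sorted n T) (act g p) ∎
      where open ≡-Reasoning
    ... | no ¬st = trans (cong (act g) (¬InBlock⇒fixed bS ¬st)) (sym (¬InBlock⇒fixed bT outside))
      where
      outside : ¬ InBlock T (act g p)
      outside st with p′ , st′ , eq ← f-surjective st =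
        ¬st (subst (InBlock S) (act-injective g (trans (agrees p′ st′) eq)) st′)

-- Heaps of words without repeated letters

NonCommuting⇒adjacent : {i j : Fin n} → NonCommuting i j →
  toℕ j ≡ suc (toℕ i) ⊎ toℕ i ≡ suc (toℕ j)
NonCommuting⇒adjacent {i = i} {j} nc with distanceView i j
... | equal refl = contradiction ≈-refl nc
... | succ p     = inj₁ p
... | pred p     = inj₂ p
... | distant d  = contradiction (commute d) nc

-- A relation between words is refuted through the action: at the point `toℕ i` the two products
-- take the values `suc k` and `suc (suc k)`.
succ⇒NonCommuting : {i j : Fin n} → toℕ j ≡ suc (toℕ i) → NonCommuting i j
succ⇒NonCommuting {i = i} {j} eq comm = 1+n≢n (sym (begin
  suc k                            ≡⟨ exchange-lower k ⟨
  exchange k k                     ≡⟨ cong (exchange k) (exchange-fixed (suc k) (1+n≢n ∘ sym) (m≢1+n+m k)) ⟨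
  exchange k (exchange (suc k) k)  ≡⟨ subst (λ l → exchange k (exchange l k) ≡ exchange l (exchange k k)) eq (act-cong comm k) ⟩
  exchange (suc k) (exchange k k)  ≡⟨ cong (exchange (suc k)) (exchange-lower k) ⟩
  exchange (suc k) (suc k)         ≡⟨ exchange-lower (suc k) ⟩
  suc (suc k)                      ∎))
  where
  open ≡-Reasoning
  k = toℕ i

lookup-injective : ∀ {a} {A : Set a} {xs : List A} → Unique xs →
  ∀ {i j} → lookup xs i ≡ lookup xs j → i ≡ j
lookup-injective (_ ∷ _)    {zero}  {zero}  _  = refl
lookup-injective (x∉ ∷ _)   {zero}  {suc j} eq = contradiction eq (All.lookup x∉ (∈-lookup j))
lookup-injective (x∉ ∷ _)   {suc i} {zero}  eq = contradiction (sym eq) (All.lookup x∉ (∈-lookup i))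
lookup-injective (_ ∷ uniq) {suc i} {suc j} eq = cong suc (lookup-injective uniq eq)

-- Invariant under cyclic shifts, hence a property of the cylindrical heap.
record Supports (S : ℕ → Bool) (H : Heap n) : Set where
  open Heap H
  letter : Fin size → ℕ
  letter a = toℕ (label a)
  field
    label-injective : ∀ {a b} → label a ≡ label b → a ≡ b
    label-letter    : ∀ a → S (letter a) ≡ true
    letter-label    : ∀ {i} → S i ≡ true → ∃ λ a → letter a ≡ i
    ≺-block         : ∀ {a b} → a ≺ b → blockStart S (letter a) ≡ blockStart S (letter b)
    comparable      : ∀ {a b} → letter b ≡ suc (letter a) → a ≺ b ⊎ b ≺ a
    between         : ∀ {a b c} → a ≺ c → c ≺ b →
                      (letter a < letter c × letter c < letter b) ⊎
                      (letter b < letter c × letter c < letter a)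

  bounded : Bounded n S
  bounded Si with a , refl ← letter-label Si = toℕ<n (label a)

module _ {u : Word n} (uniq : Unique u) where

  private
    letterAt : Fin (length u) → ℕ
    letterAt a = toℕ (lookup u a)

    letterAt-injective : ∀ {a b} → letterAt a ≡ letterAt b → a ≡ b
    letterAt-injective = lookup-injective uniq ∘ toℕ-injective

    Rising Falling : Fin (length u) → Fin (length u) → Set
    Rising  a b = Below u a b × letterAt b ≡ suc (letterAt a)
    Falling a b = Below u a b × letterAt a ≡ suc (letterAt b)

    Below⇒> : ∀ {a b} → Below u b a → a Fin.< b
    Below⇒> (below a<b _) = a<b

    first-step : ∀ {R : Fin (length u) → Fin (length u) → Set} {a b} → TransClosure R a b → ∃ (R a)
    first-step Plus.[ r ] = _ , r
    first-step (r ∷ _)    = _ , r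

    -- Letters change by one along a chain in the heap. A chain that turned around would meet a
    -- letter twice, hence one position twice, although positions strictly decrease; so chains are
    -- monotone in their letters.
    no-return : ∀ {a b c} → letterAt a ≡ letterAt c → Below u a b → Below u b c → ⊥
    no-return eq p q with refl ← letterAt-injective eq = Fin.<-asym (Below⇒> p) (Below⇒> q)

    no-peak : ∀ {a b c} → TransClosure Rising a b → TransClosure Falling b c → ⊥
    no-peak (_ ∷ rs)         fs = no-peak rs fs
    no-peak Plus.[ p , eq ]  fs with _ , q , eq′ ← first-step fs =
      no-return (suc-injective (trans (sym eq) eq′)) p q

    no-valley : ∀ {a b c} → TransClosure Falling a b → TransClosure Rising b c → ⊥
    no-valley (_ ∷ fs)         rs = no-valley fs rs
    no-valley Plus.[ p , eq ]  rs with _ , q , eq′ ← first-step rs =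
      no-return (trans eq (sym eq′)) p q

    step : ∀ {a b} → Below u a b → Rising a b ⊎ Falling a b
    step p@(below _ nc) with NonCommuting⇒adjacent nc
    ... | inj₁ eq = inj₂ (p , eq)
    ... | inj₂ eq = inj₁ (p , eq)

    monotone : ∀ {a b} → TransClosure (Below u) a b → TransClosure Rising a b ⊎ TransClosure Falling a b
    monotone Plus.[ p ] with step p
    ... | inj₁ r = inj₁ Plus.[ r ]
    ... | inj₂ f = inj₂ Plus.[ f ]
    monotone (p ∷ ps) with step p | monotone ps
    ... | inj₁ r | inj₁ rs = inj₁ (r ∷ rs)
    ... | inj₁ r | inj₂ fs = ⊥-elim (no-peak Plus.[ r ] fs)
    ... | inj₂ f | inj₁ rs = ⊥-elim (no-valley Plus.[ f ] rs)
    ... | inj₂ f | inj₂ fs = inj₂ (f ∷ fs)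

    Rising⇒< : ∀ {a b} → TransClosure Rising a b → letterAt a < letterAt b
    Rising⇒< Plus.[ _ , eq ]  = ≤-reflexive (sym eq)
    Rising⇒< ((_ , eq) ∷ rs)  = <-trans (≤-reflexive (sym eq)) (Rising⇒< rs)

    Falling⇒> : ∀ {a b} → TransClosure Falling a b → letterAt b < letterAt a
    Falling⇒> Plus.[ _ , eq ]  = ≤-reflexive (sym eq)
    Falling⇒> ((_ , eq) ∷ fs)  = <-trans (Falling⇒> fs) (≤-reflexive (sym eq))

  heap-Supports : ∀ {S} → Bounded n S → HasLetters S u → Supports S (heap u)
  heap-Supports {S} bd h = record
    { label-injective = lookup-injective uniq
    ; label-letter    = letter-S
    ; letter-label    = letter-label
    ; ≺-block         = ≺-block
    ; comparable      = comparable
    ; between         = between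
    }
    where
    letter-S : ∀ a → S (letterAt a) ≡ true
    letter-S a = Equivalence.to (h _) (∈-lookup a)

    letter-label : ∀ {i} → S i ≡ true → ∃ λ a → letterAt a ≡ i
    letter-label {i} Si = index i∈u , trans (cong toℕ (sym (lookup-index i∈u))) (toℕ-fromℕ< (bd Si))
      where
      i∈u : fromℕ< (bd Si) ∈ u
      i∈u = Equivalence.from (h _) (trans (cong S (toℕ-fromℕ< (bd Si))) Si)

    succ-block : ∀ a b → letterAt b ≡ suc (letterAt a) →
      blockStart S (letterAt a) ≡ blockStart S (letterAt b)
    succ-block a b eq = sym (trans (cong (blockStart S) eq) (blockStart-suc {S} (letter-S a)))

    Below-block : ∀ {a b} → Below u a b → blockStart S (letterAt a) ≡ blockStart S (letterAt b)
    Below-block {a} {b} p with step p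
    ... | inj₁ (_ , eq) = succ-block a b eq
    ... | inj₂ (_ , eq) = sym (succ-block b a eq)

    ≺-block : ∀ {a b} → TransClosure (Below u) a b →
      blockStart S (letterAt a) ≡ blockStart S (letterAt b)
    ≺-block Plus.[ p ] = Below-block p
    ≺-block (p ∷ ps)   = trans (Below-block p) (≺-block ps)

    comparable : ∀ {a b} → letterAt b ≡ suc (letterAt a) →
      TransClosure (Below u) a b ⊎ TransClosure (Below u) b a
    comparable {a} {b} eq with Fin.<-cmp a b
    ... | tri< a<b _ _  = inj₂ Plus.[ below a<b (succ⇒NonCommuting eq) ]
    ... | tri≈ _ refl _ = contradiction (sym eq) 1+n≢n
    ... | tri> _ _ b<a  = inj₁ Plus.[ below b<a (succ⇒NonCommuting eq ∘ ≈-sym) ]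

    between : ∀ {a b c} → TransClosure (Below u) a c → TransClosure (Below u) c b →
      (letterAt a < letterAt c × letterAt c < letterAt b) ⊎
      (letterAt b < letterAt c × letterAt c < letterAt a)
    between p q with monotone p | monotone q
    ... | inj₁ rs | inj₁ rs′ = inj₁ (Rising⇒< rs , Rising⇒< rs′)
    ... | inj₁ rs | inj₂ fs  = ⊥-elim (no-peak rs fs)
    ... | inj₂ fs | inj₁ rs  = ⊥-elim (no-valley fs rs)
    ... | inj₂ fs | inj₂ fs′ = inj₂ (Falling⇒> fs′ , Falling⇒> fs)

≅-sym : {H K : Heap n} → H ≅ K → K ≅ H
≅-sym {H = H} {K} iso = record
  { blocks    = ↔-sym blocks
  ; ≺-iso     = λ a b → mk⇔
      (λ p → from (≺-iso _ _) (subst₂ (Heap._≺_ K) (sym (strictlyInverseˡ a)) (sym (strictlyInverseˡ b)) p))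
      (λ p → subst₂ (Heap._≺_ K) (strictlyInverseˡ a) (strictlyInverseˡ b) (to (≺-iso _ _) p))
  ; label-iso = λ a → trans (sym (label-iso _)) (cong (Heap.label K) (strictlyInverseˡ a))
  }
  where
  open _≅_ iso using (blocks; ≺-iso; label-iso)
  open Inverse blocks using (strictlyInverseˡ)
  open Equivalence

Supports-≅ : ∀ {S} {H K : Heap n} → H ≅ K → Supports S K → Supports S H
Supports-≅ {S = S} {H} {K} iso sup = record
  { label-injective = λ {a} {b} eq → injective
      (label-injective (trans (label-iso a) (trans eq (sym (label-iso b)))))
  ; label-letter    = λ a → subst (λ i → S i ≡ true) (same a) (label-letter (to a))
  ; letter-label    = λ Si → case letter-label Si of λ where
      (b , refl) → from b , trans (sym (same (from b))) (cong letter (strictlyInverseˡ b))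
  ; ≺-block         = λ {a} {b} a≺b → subst₂ (λ i j → blockStart S i ≡ blockStart S j) (same a) (same b)
      (≺-block (↑ a≺b))
  ; comparable      = λ {a} {b} eq → Sum.map ↓ ↓
      (comparable (trans (same b) (trans eq (cong suc (sym (same a))))))
  ; between         = λ {a} {b} {c} a≺c c≺b →
      subst (λ i → (i < toℕ (H.label c) × _) ⊎ (_ × toℕ (H.label c) < i)) (same a)
      (subst (λ j → (_ × toℕ (H.label c) < j) ⊎ (j < toℕ (H.label c) × _)) (same b)
      (subst (λ k → (letter (to a) < k × k < letter (to b)) ⊎ (letter (to b) < k × k < letter (to a))) (same c)
        (between (↑ a≺c) (↑ c≺b))))
  }
  where
  module H = Heap H
  module K = Heap K
  open _≅_ iso
  open Inverse blocks using (from; strictlyInverseˡ; strictlyInverseʳ)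
  open Supports sup
  injective : ∀ {a b} → to a ≡ to b → a ≡ b
  injective eq = trans (sym (strictlyInverseʳ _)) (trans (cong from eq) (strictlyInverseʳ _))
  same : ∀ a → letter (to a) ≡ toℕ (H.label a)
  same a = cong toℕ (label-iso a)
  ↑ : ∀ {a b} → a H.≺ b → to a K.≺ to b
  ↑ = Equivalence.to (≺-iso _ _)
  ↓ : ∀ {a b} → to a K.≺ to b → a H.≺ b
  ↓ = Equivalence.from (≺-iso _ _)

Supports⇒HasLetters : ∀ {S} {u : Word n} → Supports S (heap u) → HasLetters S u
Supports⇒HasLetters {S = S} {u} sup i = mk⇔
  (λ i∈u → subst (λ j → S (toℕ j) ≡ true) (sym (lookup-index i∈u)) (label-letter (index i∈u)))
  (λ Si → case letter-label Si of λ where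
    (a , eq) → subst (_∈ u) (toℕ-injective eq) (∈-lookup a))
  where open Supports sup

HasLetters-↭ : ∀ {S} {u v : Word n} → u ↭ v → HasLetters S u → HasLetters S v
HasLetters-↭ p h i = mk⇔ (Equivalence.to (h i) ∘ ∈-resp-↭ (↭-sym p)) (∈-resp-↭ p ∘ Equivalence.from (h i))

-- A cyclic shift changes the order of the heap. Only the letter set is carried over, and the
-- remaining properties are derived anew for the rotated word.
Supports-↭ : ∀ {S} {u v : Word n} {H K : Heap n} → Unique u → u ↭ v →
  H ≅ heap u → K ≅ heap v → Supports S H → Supports S K
Supports-↭ {S = S} uniq p H≅u K≅v sup = Supports-≅ K≅v
  (heap-Supports (Unique-resp-↭ p uniq) (Supports.bounded sup)
    (HasLetters-↭ {S = S} p (Supports⇒HasLetters (Supports-≅ (≅-sym H≅u) sup))))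

Supports-∼ : ∀ {S} {H K : Heap n} → H ∼ K → Supports S H → Supports S K
Supports-∼ ε sup = sup
Supports-∼ (fwd (inj₁ iso) ◅ ss) sup = Supports-∼ ss (Supports-≅ (≅-sym iso) sup)
Supports-∼ (bwd (inj₁ iso) ◅ ss) sup = Supports-∼ ss (Supports-≅ iso sup)
Supports-∼ (fwd (inj₂ (i , u , cfc , red , H≅ , K≅)) ◅ ss) sup =
  Supports-∼ ss (Supports-↭ (CFC⇒Unique cfc (≈-refl , red)) (∷↭∷ʳ i u) H≅ K≅ sup)
Supports-∼ (bwd (inj₂ (i , u , cfc , red , K≅ , H≅)) ◅ ss) sup =
  Supports-∼ ss (Supports-↭ (Unique-resp-↭ (∷↭∷ʳ i u) (CFC⇒Unique cfc (≈-refl , red)))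
    (↭-sym (∷↭∷ʳ i u)) H≅ K≅ sup)

-- The invariant that separates rings: distinct chunks have disjoint sets of labels, so one
-- preserved label identifies the chunk.
HasLabel : Heap n → Fin n → Set
HasLabel H i = ∃ λ a → Heap.label H a ≡ i

HasLabel-≅ : ∀ {H K : Heap n} {i} → H ≅ K → HasLabel H i → HasLabel K i
HasLabel-≅ iso (a , refl) = _≅_.to iso a , _≅_.label-iso iso a

HasLabel-↭ : ∀ {u v : Word n} {i} → u ↭ v → HasLabel (heap u) i → HasLabel (heap v) i
HasLabel-↭ p (a , refl) = index a∈v , sym (lookup-index a∈v)
  where a∈v = ∈-resp-↭ p (∈-lookup a)

HasLabel-∼ : ∀ {H K : Heap n} {i} → H ∼ K → HasLabel H i → HasLabel K i
HasLabel-∼ ε                     = id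
HasLabel-∼ (fwd (inj₁ iso) ◅ ss) = HasLabel-∼ ss ∘ HasLabel-≅ iso
HasLabel-∼ (bwd (inj₁ iso) ◅ ss) = HasLabel-∼ ss ∘ HasLabel-≅ (≅-sym iso)
HasLabel-∼ (fwd (inj₂ (i , u , _ , _ , H≅ , K≅)) ◅ ss) =
  HasLabel-∼ ss ∘ HasLabel-≅ (≅-sym K≅) ∘ HasLabel-↭ (∷↭∷ʳ i u) ∘ HasLabel-≅ H≅
HasLabel-∼ (bwd (inj₂ (i , u , _ , _ , K≅ , H≅)) ◅ ss) =
  HasLabel-∼ ss ∘ HasLabel-≅ (≅-sym K≅) ∘ HasLabel-↭ (↭-sym (∷↭∷ʳ i u)) ∘ HasLabel-≅ H≅

∼-reflexive : {H K : Heap n} → H ≡ K → H ∼ K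
∼-reflexive refl = ε

-- Chunks are blocks

enumerate-∈ : ∀ {k} (C : Subset k) e → enumerate C e ∈ₛ C
enumerate-∈ (true  ∷ C) zero    = here
enumerate-∈ (true  ∷ C) (suc e) = there (enumerate-∈ C e)
enumerate-∈ (false ∷ C) e       = there (enumerate-∈ C e)

enumerate-surjective : ∀ {k} (C : Subset k) {a} → a ∈ₛ C → ∃ λ e → enumerate C e ≡ a
enumerate-surjective (true  ∷ C) here = zero , refl
enumerate-surjective (true  ∷ C) (there a∈C) with e , refl ← enumerate-surjective C a∈C = suc e , refl
enumerate-surjective (false ∷ C) (there a∈C) with e , refl ← enumerate-surjective C a∈C = e , refl

enumerate-injective : ∀ {k} (C : Subset k) {d e} → enumerate C d ≡ enumerate C e → d ≡ e
enumerate-injective (true  ∷ C) {zero}  {zero}  _  = refl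
enumerate-injective (true  ∷ C) {suc d} {suc e} eq = cong suc (enumerate-injective C (Fin.suc-injective eq))
enumerate-injective (false ∷ C) eq = enumerate-injective C (Fin.suc-injective eq)

subset : ∀ {k p} {P : Pred (Fin k) p} → Decidable P → Subset k
subset P? = tabulate (does ∘ P?)

∈-subset : ∀ {k p} {P : Pred (Fin k) p} (P? : Decidable P) {a} → a ∈ₛ subset P? ⇔ P a
∈-subset P? {a} = mk⇔
  (λ a∈ → does-true (P? a) (trans (sym (lookup∘tabulate _ a)) ([]=⇒lookup a∈)))
  (λ Pa → lookup⇒[]= a _ (trans (lookup∘tabulate _ a) (dec-true (P? a) Pa)))
  where
  does-true : ∀ {p} {P : Set p} (P? : Dec P) → does P? ≡ true → P
  does-true (yes p) _ = p

module _ {S : ℕ → Bool} {H : Heap n} (sup : Supports S H) where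
  open Heap H
  open Supports sup

  start : Fin size → ℕ
  start a = blockStart S (letter a)

  Connected⇒start : ∀ {a b} → Connected a b → start a ≡ start b
  Connected⇒start ε                    = refl
  Connected⇒start (fwd (a≺c , _) ◅ cs) = trans (≺-block a≺c) (Connected⇒start cs)
  Connected⇒start (bwd (c≺a , _) ◅ cs) = trans (sym (≺-block c≺a)) (Connected⇒start cs)

  -- By `between`, an intermediate element would have its letter strictly between two consecutive
  -- numbers, so the comparable pair is an edge of the Hasse diagram.
  adjacent-connected : ∀ {a b} → letter b ≡ suc (letter a) → Connected b a
  adjacent-connected {a} {b} eq with comparable eq
  ... | inj₁ a≺b = bwd (a≺b , λ (c , a≺c , c≺b) → case between a≺c c≺b of λ where
    (inj₁ (a<c , c<b)) → <⇒≱ (subst (letter c <_) eq c<b) a<c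
    (inj₂ (b<c , c<a)) → <-asym (<-trans b<c c<a) (≤-reflexive (sym eq))) ◅ ε
  ... | inj₂ b≺a = fwd (b≺a , λ (c , b≺c , c≺a) → case between b≺c c≺a of λ where
    (inj₁ (b<c , c<a)) → <-asym (<-trans b<c c<a) (≤-reflexive (sym eq))
    (inj₂ (a<c , c<b)) → <⇒≱ (subst (letter c <_) eq c<b) a<c) ◅ ε

  connected-to-start : ∀ i {a} → letter a ≡ i → ∃ λ c → letter c ≡ blockStart S i × Connected a c
  connected-to-start zero    {a} eq = a , eq , ε
  connected-to-start (suc i) {a} eq with S i in Si
  ... | false = a , eq , ε
  ... | true
      with b , refl ← letter-label Si
      with c , eq′ , b~c ← connected-to-start i {b} refl = c , eq′ , adjacent-connected eq ◅◅ b~c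

  start⇒Connected : ∀ {a b} → start a ≡ start b → Connected a b
  start⇒Connected {a} {b} eq
    with c , eqᶜ , a~c ← connected-to-start _ {a} refl
    with d , eqᵈ , b~d ← connected-to-start _ {b} refl
    with refl ← label-injective (toℕ-injective (trans eqᶜ (trans eq (sym eqᵈ)))) =
    a~c ◅◅ EqC.symmetric _ b~d

  chunkOf : Fin size → Chunk H
  chunkOf a = record
    { support   = subset sameBlock?
    ; nonempty  = a , from (∈-subset sameBlock?) refl
    ; component = λ {c} c∈ b → mk⇔
        (λ b∈ → start⇒Connected (trans (to (∈-subset sameBlock?) c∈) (sym (to (∈-subset sameBlock?) b∈))))
        (λ c~b → from (∈-subset sameBlock?) (trans (sym (Connected⇒start c~b)) (to (∈-subset sameBlock?) c∈)))
    ; convex    = λ a∈ _ a≺b _ →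
        from (∈-subset sameBlock?) (trans (sym (≺-block a≺b)) (to (∈-subset sameBlock?) a∈))
    }
    where
    open Equivalence
    sameBlock? : Decidable (λ b → start b ≡ start a)
    sameBlock? b = start b ≟ start a

  chunkStart : Chunk H → ℕ
  chunkStart C = start (proj₁ (Chunk.nonempty C))

  ∈-chunk : ∀ C {b} → b ∈ₛ Chunk.support C ⇔ start b ≡ chunkStart C
  ∈-chunk C {b} = mk⇔
    (λ b∈C → sym (Connected⇒start (to (component a∈C b) b∈C)))
    (λ eq → from (component a∈C b) (start⇒Connected (sym eq)))
    where
    open Equivalence
    open Chunk C
    a∈C = proj₂ nonempty

  chunkStart-isStart : ∀ C → IsStart S (chunkStart C)
  chunkStart-isStart C = blockStart-idem (letter a) , start-letter {S} (label-letter a)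
    where a = proj₁ (Chunk.nonempty C)

  startChunk : ∀ {k} → IsStart S k → Chunk H
  startChunk (_ , Sk) = chunkOf (proj₁ (letter-label Sk))

  chunkStart-startChunk : ∀ {k} (st : IsStart S k) → chunkStart (startChunk st) ≡ k
  chunkStart-startChunk (st , Sk) = trans (cong (blockStart S) (proj₂ (letter-label Sk))) st

  -- The start determines the support by `∈-chunk`, and `asHeap` depends on the support alone.
  chunkStart⇒∼ : ∀ C D → chunkStart C ≡ chunkStart D → Chunk.asHeap C ∼ Chunk.asHeap D
  chunkStart⇒∼ C D eq = ∼-reflexive (cong (subheap H) (⊆-antisym
    (λ a∈ → from (∈-chunk D) (trans (to (∈-chunk C) a∈) eq))
    (λ a∈ → from (∈-chunk C) (trans (to (∈-chunk D) a∈) (sym eq)))))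
    where open Equivalence

  ∼⇒chunkStart : ∀ C D → Chunk.asHeap C ∼ Chunk.asHeap D → chunkStart C ≡ chunkStart D
  ∼⇒chunkStart C D C∼D
    with e , eq ← enumerate-surjective (Chunk.support C) (proj₂ (Chunk.nonempty C))
    with d , eq′ ← HasLabel-∼ C∼D (e , refl) = begin
      chunkStart C                            ≡⟨ cong start eq ⟨
      start (enumerate (Chunk.support C) e)   ≡⟨ cong (blockStart S ∘ toℕ) eq′ ⟨
      start (enumerate (Chunk.support D) d)   ≡⟨ Equivalence.to (∈-chunk D) (enumerate-∈ (Chunk.support D) d) ⟩
      chunkStart D                            ∎
    where open ≡-Reasoning

  chunk-size : ∀ C → Chunk.size C ≡ runLength n S (chunkStart C)
  chunk-size C = ≤-antisym (injective⇒≤ {f = offset} offset-injective)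
                           (injective⇒≤ {f = position} position-injective)
    where
    open Chunk C using (support)
    k = chunkStart C
    k-start = proj₁ (chunkStart-isStart C)
    element : Fin (Chunk.size C) → Fin size
    element = enumerate support
    element-start : ∀ e → start (element e) ≡ k
    element-start e = Equivalence.to (∈-chunk C) (enumerate-∈ support e)
    k≤ : ∀ e → k ≤ letter (element e)
    k≤ e = subst (_≤ letter (element e)) (element-start e) (blockStart-≤ {S} _)
    offset< : ∀ e → letter (element e) ∸ k < runLength n S k
    -- Strict, because the letter `i` brings the point `i + 1` into the same block.
    offset< e = begin-strict
      i ∸ k                            <⟨ ∸-monoˡ-< (n<1+n i) (k≤ e) ⟩
      suc i ∸ k                        ≡⟨ cong (suc i ∸_) block ⟨
      suc i ∸ blockStart S (suc i)     ≤⟨ offset-≤ bounded (suc i) ⟩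
      runLength n S (blockStart S (suc i)) ≡⟨ cong (runLength n S) block ⟩
      runLength n S k                  ∎
      where
      open ≤-Reasoning
      i = letter (element e)
      block : blockStart S (suc i) ≡ k
      block = trans (blockStart-suc {S} (label-letter (element e))) (element-start e)
    offset : Fin (Chunk.size C) → Fin (runLength n S k)
    offset e = fromℕ< (offset< e)
    offset-injective : ∀ {d e} → offset d ≡ offset e → d ≡ e
    offset-injective {d} {e} eq = enumerate-injective support (label-injective (toℕ-injective
      (∸-cancelʳ-≡ (k≤ d) (k≤ e)
        (trans (sym (toℕ-fromℕ< (offset< d))) (trans (cong toℕ eq) (toℕ-fromℕ< (offset< e)))))))
    locate : ∀ (t : Fin (runLength n S k)) → ∃ λ e → letter (element e) ≡ k + toℕ t
    locate t with b , eq ← letter-label (run-letters n k (toℕ t) (toℕ<n t))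
      with e , refl ← enumerate-surjective support {b} (Equivalence.from (∈-chunk C)
             (trans (cong (blockStart S) eq) (blockStart-run n (toℕ t) k-start (<⇒≤ (toℕ<n t)))))
      = e , eq
    position : Fin (runLength n S k) → Fin (Chunk.size C)
    position t = proj₁ (locate t)
    position-injective : ∀ {s t} → position s ≡ position t → s ≡ t
    position-injective {s} {t} eq = toℕ-injective (+-cancelˡ-≡ k _ _
      (trans (sym (proj₂ (locate s))) (trans (cong (letter ∘ element) eq) (proj₂ (locate t)))))

-- Ring equivalence as a bijection of blocks

module _ {S T : ℕ → Bool} {H K : Heap n} (supH : Supports S H) (supK : Supports T K) where

  startMap : (Chunk H → Chunk K) → ℕ → ℕ
  startMap φ k with isStart? S k
  ... | yes st = chunkStart supK (φ (startChunk supH st))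
  -- A default value at points that start no nontrivial block.
  ... | no _   = 0

  startMap-chunk : ∀ φ → (∀ {C D} → Chunk.asHeap C ∼ Chunk.asHeap D → Chunk.asHeap (φ C) ∼ Chunk.asHeap (φ D)) →
    ∀ C → startMap φ (chunkStart supH C) ≡ chunkStart supK (φ C)
  startMap-chunk φ φ-cong C with isStart? S (chunkStart supH C)
  ... | yes st = ∼⇒chunkStart supK (φ (startChunk supH st)) (φ C) (φ-cong {startChunk supH st} {C}
                   (chunkStart⇒∼ supH (startChunk supH st) C (chunkStart-startChunk supH st)))
  ... | no ¬st = contradiction (chunkStart-isStart supH C) ¬st

  -- Every start comes from a chunk, so a property of starts may be checked on chunks, where
  -- `startMap-chunk` computes.
  chunks-induct : ∀ {p} {P : ℕ → Set p} → (∀ C → P (chunkStart supH C)) → ∀ {k} → IsStart S k → P k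
  chunks-induct {P = P} all st = subst P (chunkStart-startChunk supH st) (all (startChunk supH st))

RingEquivalent⇔BlockBijection : ∀ {S T} {H K : Heap n} → Supports S H → Supports T K →
  RingEquivalent H K ⇔ BlockBijection n S T
RingEquivalent⇔BlockBijection {n} {S} {T} {H} {K} supH supK = mk⇔ ⇒ ⇐
  where
  ⇒ : RingEquivalent H K → BlockBijection n S T
  ⇒ (φ , φ-size) = record
    { to         = f
    ; from       = g
    ; to-start   = onStartsH λ C → subst (IsStart T) (sym (f-chunk C)) (chunkStart-isStart supK (φ.to C))
    ; from-start = onStartsK λ D → subst (IsStart S) (sym (g-chunk D)) (chunkStart-isStart supH (φ.from D))
    ; to-run     = onStartsH λ C → begin
        runLength n T (f (chunkStart supH C))          ≡⟨ cong (runLength n T) (f-chunk C) ⟩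
        runLength n T (chunkStart supK (φ.to C))       ≡⟨ chunk-size supK (φ.to C) ⟨
        Chunk.size (φ.to C)                            ≡⟨ φ-size C ⟩
        Chunk.size C                                   ≡⟨ chunk-size supH C ⟩
        runLength n S (chunkStart supH C)              ∎
    ; from-to    = onStartsH λ C → begin
        g (f (chunkStart supH C))             ≡⟨ cong g (f-chunk C) ⟩
        g (chunkStart supK (φ.to C))          ≡⟨ g-chunk (φ.to C) ⟩
        chunkStart supH (φ.from (φ.to C))     ≡⟨ ∼⇒chunkStart supH (φ.from (φ.to C)) C (φ.strictlyInverseʳ C) ⟩
        chunkStart supH C                     ∎
    ; to-from    = onStartsK λ D → begin
        f (g (chunkStart supK D))             ≡⟨ cong f (g-chunk D) ⟩
        f (chunkStart supH (φ.from D))        ≡⟨ f-chunk (φ.from D) ⟩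
        chunkStart supK (φ.to (φ.from D))     ≡⟨ ∼⇒chunkStart supK (φ.to (φ.from D)) D (φ.strictlyInverseˡ D) ⟩
        chunkStart supK D                     ∎
    }
    where
    open ≡-Reasoning
    module φ = Inverse φ
    f = startMap supH supK φ.to
    g = startMap supK supH φ.from
    f-chunk : ∀ C → f (chunkStart supH C) ≡ chunkStart supK (φ.to C)
    f-chunk = startMap-chunk supH supK φ.to (λ {C} {D} → φ.to-cong {C} {D})
    g-chunk : ∀ D → g (chunkStart supK D) ≡ chunkStart supH (φ.from D)
    g-chunk = startMap-chunk supK supH φ.from (λ {C} {D} → φ.from-cong {C} {D})
    onStartsH = λ {P} → chunks-induct supH supK {P = P}
    onStartsK = λ {P} → chunks-induct supK supH {P = P}

  ⇐ : BlockBijection n S T → RingEquivalent H K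
  ⇐ B = record
    { to        = φ
    ; from      = ψ
    ; to-cong   = λ {C} {D} C∼D → chunkStart⇒∼ supK (φ C) (φ D)
        (trans (φ-start C) (trans (cong to (∼⇒chunkStart supH C D C∼D)) (sym (φ-start D))))
    ; from-cong = λ {C} {D} C∼D → chunkStart⇒∼ supH (ψ C) (ψ D)
        (trans (ψ-start C) (trans (cong from (∼⇒chunkStart supK C D C∼D)) (sym (ψ-start D))))
    ; inverse   =
        (λ {D} {C} C∼ψD → chunkStart⇒∼ supK (φ C) D (begin
          chunkStart supK (φ C)             ≡⟨ φ-start C ⟩
          to (chunkStart supH C)            ≡⟨ cong to (∼⇒chunkStart supH C (ψ D) C∼ψD) ⟩
          to (chunkStart supH (ψ D))        ≡⟨ cong to (ψ-start D) ⟩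
          to (from (chunkStart supK D))     ≡⟨ to-from (chunkStart-isStart supK D) ⟩
          chunkStart supK D                 ∎)) ,
        (λ {C} {D} D∼φC → chunkStart⇒∼ supH (ψ D) C (begin
          chunkStart supH (ψ D)             ≡⟨ ψ-start D ⟩
          from (chunkStart supK D)          ≡⟨ cong from (∼⇒chunkStart supK D (φ C) D∼φC) ⟩
          from (chunkStart supK (φ C))      ≡⟨ cong from (φ-start C) ⟩
          from (to (chunkStart supH C))     ≡⟨ from-to (chunkStart-isStart supH C) ⟩
          chunkStart supH C                 ∎))
    } , λ C → begin
      Chunk.size (φ C)                         ≡⟨ chunk-size supK (φ C) ⟩
      runLength n T (chunkStart supK (φ C))    ≡⟨ cong (runLength n T) (φ-start C) ⟩
      runLength n T (to (chunkStart supH C))   ≡⟨ to-run (chunkStart-isStart supH C) ⟩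
      runLength n S (chunkStart supH C)        ≡⟨ chunk-size supH C ⟨
      Chunk.size C                             ∎
    where
    open ≡-Reasoning
    open BlockBijection B
    φ : Chunk H → Chunk K
    φ C = startChunk supK (to-start (chunkStart-isStart supH C))
    ψ : Chunk K → Chunk H
    ψ D = startChunk supH (from-start (chunkStart-isStart supK D))
    φ-start : ∀ C → chunkStart supK (φ C) ≡ to (chunkStart supH C)
    φ-start C = chunkStart-startChunk supK (to-start (chunkStart-isStart supH C))
    ψ-start : ∀ D → chunkStart supH (ψ D) ≡ from (chunkStart supK D)
    ψ-start D = chunkStart-startChunk supH (from-start (chunkStart-isStart supK D))

-- Letter sets of cylindrical heaps, and the theorem

letters : Word n → ℕ → Bool
letters u i = does (Any.any? (λ j → toℕ j ≟ i) u)

letters-∈ : ∀ {u : Word n} {i} → letters u i ≡ true ⇔ Any (λ j → toℕ j ≡ i) u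
letters-∈ {u = u} {i} with Any.any? (λ j → toℕ j ≟ i) u
... | yes p = mk⇔ (λ _ → p) (λ _ → refl)
... | no ¬p = mk⇔ (λ ()) (λ p → contradiction p ¬p)

letters-HasLetters : ∀ (u : Word n) → HasLetters (letters u) u
letters-HasLetters u i = mk⇔
  (λ i∈u → Equivalence.from letters-∈ (Any.map (cong toℕ ∘ sym) i∈u))
  (λ eq → Any.map (sym ∘ toℕ-injective) (Equivalence.to letters-∈ eq))

letters-Bounded : ∀ (u : Word n) → Bounded n (letters u)
letters-Bounded u eq = subst (_< _) (lookup-index p) (toℕ<n _)
  where p = Equivalence.to (letters-∈ {u = u}) eq

-- One letter set links the two sides: the rings of `H` are read off from it, and `w` is conjugate
-- to its sorted product.
record Representative (w : Word n) (H : Heap n) : Set where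
  field
    support  : ℕ → Bool
    supports : Supports support H
    sorts    : Conj w (sorted n support)

representative : {w : Word n} {H : Heap n} → CFC w → Ĥ w H → Representative w H
representative {n} cfc (u , red@(u≈w , _) , u∼H) = record
  { support  = letters u
  ; supports = Supports-∼ u∼H (heap-Supports uniq (letters-Bounded u) (letters-HasLetters u))
  ; sorts    = Conj-trans (≈⇒Conj (≈-sym u≈w)) (Step*⇒Conj (sort n (letters u) uniq (letters-HasLetters u)))
  }
  where uniq = CFC⇒Unique cfc red

theorem3p2p1 : ∀ (n : ℕ) (w y : Group.Carrier (W-A n)) → CFC w → CFC y →
    ∀ {Hw Hy : Heap n} → Ĥ w Hw → Ĥ y Hy →
    Conjugate (W-A n) w y ⇔ RingEquivalent Hw Hy
theorem3p2p1 n w y cfc-w cfc-y hw hy = mk⇔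
  (λ c → from rings (Conj⇒BlockBijection bounded₁ bounded₂
    (Conj-trans (Conj-sym R₁.sorts) (Conj-trans (to Conjugate⇔Conj c) R₂.sorts))))
  (λ r → from Conjugate⇔Conj (Conj-trans R₁.sorts
    (Conj-trans (BlockBijection⇒Conj bounded₁ bounded₂ (to rings r)) (Conj-sym R₂.sorts))))
  where
  open Equivalence
  module R₁ = Representative (representative cfc-w hw)
  module R₂ = Representative (representative cfc-y hy)
  bounded₁ = λ {i} → Supports.bounded R₁.supports {i}
  bounded₂ = λ {i} → Supports.bounded R₂.supports {i}
  rings = RingEquivalent⇔BlockBijection R₁.supports R₂.supports
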